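{- Let $\mathcal M(C^n)$ be an oriented cube over $C^n=\{ -1,1\}^n$. If $\mathcal M(C^n)$ is realizable (as an oriented matroid, over $\mathbb{R}$), then $\mathcal M(C^n)\simeq \mathbf{Q}_n$.
   Context: Signed sets are written $X=(X^+,X^-)$. $C^n=\{ -1,1\}^n$; for $B\subseteq[n]$ and $v\in C^n$, ${}_{ -B}v$ is obtained from $v$ by changing the sign of the coordinates indexed by $B$. The real cube is $\mathbf{Q}_n=\mathrm{Aff}(C^n)$, the oriented matroid of affine dependencies of $C^n$ over $\mathbb{R}$. The signed rectangles are the signed sets $(\{v,{}_{ -(A\cup B)}v\},\{{}_{ -A}v,{}_{ -B}v\})$ with $v\in C^n$ and $A,B\subseteq[n]$ disjoint and nonempty. The facets are $H_{i+}=\{v\in C^n:v(i)=1\}$, $H_{i- }=\{v\in C^n:v(i)=-1\}$; the skew-facets are $H_{ij+}=\{v\in C^n:v(i)=v(j)\}$, $H_{ij- }=\{v\in C^n:v(i)=-v(j)\}$ ($i\ne j$). An oriented cube over $C^n$ is an oriented matroid on the ground set $C^n$ such that all signed rectangles are signed circuits and all signed cocircuits of $\mathbf{Q}_n$ complementary to facets and skew-facets are signed cocircuits. $\simeq$ denotes isomorphism of oriented matroids. -}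

module Defs where

open import Level using (0ℓ)
open import Algebra.Bundles using (CommutativeRing)
open import Data.Bool.Base using (if_then_else_)
open import Data.Fin.Base using (Fin)
open import Data.Fin.Subset as Subset using (Subset; Nonempty; Empty)
open import Data.Maybe.Base as Maybe using (Maybe; just; nothing)
open import Data.Nat.Base using (ℕ; zero; suc)
open import Data.Product.Base using (Σ-syntax; ∃-syntax; _×_)
open import Data.Sign.Base as Sign using (Sign)
open import Data.Sum.Base using (_⊎_)
open import Data.Vec.Base using (Vec; []; _∷_; lookup; zipWith)
open import Function.Base using (_∘_)
open import Function.Bundles using (_⇔_; _↔_; Inverse)
open import Relation.Binary.Core using (Rel)
open import Relation.Binary.PropositionalEquality.Core using (_≡_; _≢_; _≗_)
open import Relation.Binary.Structures using (IsStrictTotalOrder)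
open import Relation.Nullary.Negation.Core using (¬_)
open import Relation.Unary
  using (Pred; _∈_; _⊆_; _≐_; _∪_; _∩_; _∖_; ∁; ｛_｝; Satisfiable)

-- The library has no real numbers.  ℝ enters as an arbitrary Dedekind-complete
-- ordered field; classically this determines ℝ up to unique isomorphism.

record Reals : Set₁ where
  field
    commutativeRing : CommutativeRing 0ℓ 0ℓ

  open CommutativeRing commutativeRing public

  infix 4 _<_ _≤_

  field
    _<_                : Rel Carrier 0ℓ
    isStrictTotalOrder : IsStrictTotalOrder _≈_ _<_
    0<1                : 0# < 1#
    +-monoʳ-<          : ∀ z {x y} → x < y → z + x < z + y
    *-pos              : ∀ {x y} → 0# < x → 0# < y → 0# < x * y
    inverse            : ∀ x → ¬ (x ≈ 0#) → ∃[ y ] x * y ≈ 1#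

  _≤_ : Rel Carrier 0ℓ
  x ≤ y = ¬ (y < x)

  UpperBound : Pred Carrier 0ℓ → Pred Carrier 0ℓ
  UpperBound P b = ∀ x → x ∈ P → x ≤ b

  field
    complete : ∀ (P : Pred Carrier 0ℓ) → Satisfiable P → Satisfiable (UpperBound P) →
               ∃[ s ] (s ∈ UpperBound P) × (∀ b → b ∈ UpperBound P → s ≤ b)

-- A signed set X = (X⁺ , X⁻) is encoded by its sign function, which is nothing
-- off the support; X⁺ and X⁻ are then disjoint by construction.

SignedSet : Set → Set
SignedSet E = E → Maybe Sign

module _ {E : Set} where

  infix 9 _⁺ _⁻

  _⁺ _⁻ supp : SignedSet E → Pred E 0ℓ
  (X ⁺) e = X e ≡ just Sign.+
  (X ⁻) e = X e ≡ just Sign.-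
  supp X e = X e ≢ nothing

  neg : SignedSet E → SignedSet E
  neg X = Maybe.map Sign.opposite ∘ X

  -- The common support of X and Y has elements where the signs agree exactly
  -- when it has elements where they differ.

  infix 4 _⊥_

  _⊥_ : Rel (SignedSet E) 0ℓ
  X ⊥ Y = Satisfiable ((X ⁺ ∩ Y ⁺) ∪ (X ⁻ ∩ Y ⁻)) ⇔
          Satisfiable ((X ⁺ ∩ Y ⁻) ∪ (X ⁻ ∩ Y ⁺))

  record IsOrientedMatroid (Circuit : Pred (SignedSet E) 0ℓ) : Set where
    field
      -- Circuit is a set of signed sets: functions are compared pointwise.
      respects     : ∀ {X Y} → X ≗ Y → Circuit X → Circuit Y
      nonempty     : ∀ {X} → Circuit X → Satisfiable (supp X)
      symmetric    : ∀ {X} → Circuit X → Circuit (neg X)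
      incomparable : ∀ {X Y} → Circuit X → Circuit Y → supp X ⊆ supp Y →
                     X ≗ Y ⊎ X ≗ neg Y
      eliminate    : ∀ {X Y} e → Circuit X → Circuit Y → ¬ (X ≗ neg Y) →
                     e ∈ X ⁺ → e ∈ Y ⁻ →
                     ∃[ Z ] Circuit Z
                       × (Z ⁺ ⊆ (X ⁺ ∪ Y ⁺) ∖ ｛ e ｝)
                       × (Z ⁻ ⊆ (X ⁻ ∪ Y ⁻) ∖ ｛ e ｝)

  -- The signed circuits of the dual: the support-minimal nonempty signed sets
  -- orthogonal to all signed circuits.

  record IsCocircuit (Circuit : Pred (SignedSet E) 0ℓ) (Y : SignedSet E) : Set where
    field
      orthogonal : ∀ X → Circuit X → X ⊥ Y
      nonempty   : Satisfiable (supp Y)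
      minimal    : ∀ Z → (∀ X → Circuit X → X ⊥ Z) → Satisfiable (supp Z) →
                   supp Z ⊆ supp Y → supp Y ⊆ supp Z

record OrientedMatroid (E : Set) : Set₁ where
  field
    Circuit           : Pred (SignedSet E) 0ℓ
    isOrientedMatroid : IsOrientedMatroid Circuit

open OrientedMatroid public using (Circuit)

-- Isomorphism of oriented matroids given by their families of signed circuits:
-- a relabelling of the ground set, with no reorientation.

infix 4 _≃_

_≃_ : {E F : Set} → Pred (SignedSet E) 0ℓ → Pred (SignedSet F) 0ℓ → Set
_≃_ {E} {F} 𝓒 𝓓 =
  Σ[ φ ∈ E ↔ F ] (∀ (Y : SignedSet F) → 𝓒 (Y ∘ Inverse.to φ) ⇔ 𝓓 Y)

C : ℕ → Set
C n = Vec Sign n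

-- flip B v is ₋B v.

flip : ∀ {n} → Subset n → C n → C n
flip = zipWith (λ b s → if b then Sign.opposite s else s)

record IsSignedRectangle {n} (X : SignedSet (C n)) : Set where
  field
    v        : C n
    A B      : Subset n
    A≢∅      : Nonempty A
    B≢∅      : Nonempty B
    disjoint : Empty (A Subset.∩ B)
    positive : X ⁺ ≐ ｛ v ｝ ∪ ｛ flip (A Subset.∪ B) v ｝
    negative : X ⁻ ≐ ｛ flip A v ｝ ∪ ｛ flip B v ｝

facet : ∀ {n} → Fin n → Sign → Pred (C n) 0ℓ
facet i s v = lookup v i ≡ s

skewFacet : ∀ {n} → Fin n → Fin n → Sign → Pred (C n) 0ℓ
skewFacet i j s v = lookup v i ≡ s Sign.* lookup v j

module _ (ℝ : Reals) where
  open Reals ℝ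

  HasSign : Maybe Sign → Pred Carrier 0ℓ
  HasSign (just Sign.+) x = 0# < x
  HasSign (just Sign.-) x = x < 0#
  HasSign nothing       x = x ≈ 0#

  -- Signed circuits of a space D of dependencies: the sign patterns of the
  -- nonzero elements of D with minimal support.

  record IsMinimalDependency {E : Set} (D : Pred (E → Carrier) 0ℓ) (X : SignedSet E) : Set where
    field
      coeff      : E → Carrier
      dependency : D coeff
      hasSigns   : ∀ e → HasSign (X e) (coeff e)
      nonempty   : Satisfiable (supp X)
      minimal    : ∀ μ → D μ → (∃[ e ] ¬ (μ e ≈ 0#)) →
                   (∀ e → ¬ (μ e ≈ 0#) → e ∈ supp X) →
                   ∀ e → e ∈ supp X → ¬ (μ e ≈ 0#)

  ∑ : ∀ n → (C n → Carrier) → Carrier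
  ∑ zero    f = f []
  ∑ (suc n) f = ∑ n (f ∘ (Sign.+ ∷_)) + ∑ n (f ∘ (Sign.- ∷_))

  module _ {n d : ℕ} (p : C n → Fin d → Carrier) where

    LinearDependency AffineDependency : Pred (C n → Carrier) 0ℓ
    LinearDependency λᵥ = ∀ k → ∑ n (λ v → λᵥ v * p v k) ≈ 0#
    AffineDependency λᵥ = ∑ n λᵥ ≈ 0# × LinearDependency λᵥ

    Lin Aff : Pred (SignedSet (C n)) 0ℓ
    Lin = IsMinimalDependency LinearDependency
    Aff = IsMinimalDependency AffineDependency

  Realizable : ∀ {n} → OrientedMatroid (C n) → Set
  Realizable {n} M =
    ∃[ d ] Σ[ p ∈ (C n → Fin d → Carrier) ] (∀ X → Circuit M X ⇔ Lin p X)

  signValue : Sign → Carrier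
  signValue Sign.+ = 1#
  signValue Sign.- = - 1#

  point : ∀ {n} → C n → Fin n → Carrier
  point v i = signValue (lookup v i)

  -- The signed circuits of the real cube.

  Q : ∀ n → Pred (SignedSet (C n)) 0ℓ
  Q n = Aff (point {n})

  record IsOrientedCube {n} (M : OrientedMatroid (C n)) : Set where
    field
      rectangles : ∀ X → IsSignedRectangle X → Circuit M X
      facets     : ∀ i s Y → IsCocircuit (Q n) Y → supp Y ≐ ∁ (facet i s) →
                   IsCocircuit (Circuit M) Y
      skewFacets : ∀ i j s Y → i ≢ j → IsCocircuit (Q n) Y → supp Y ≐ ∁ (skewFacet i j s) →
                   IsCocircuit (Circuit M) Y

{-# OPTIONS --safe #-}
module Submission where

-- A realization of M is replaced by its space D of linear dependencies.  A signed set
-- orthogonal to all circuits never meets the support of an element of D in a single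
-- vertex; this is applied to the facet cocircuits.  With 𝟎 and 𝟏 the all-plus and the
-- all-minus vertex, the rectangle on 𝟎, A, its complement and 𝟏 gives the vertex A a
-- positive weight, and the facets force every rectangle dependency on 𝟎, A, B, A ∪ B
-- to have, up to a factor, weights 1, -1, -1 at A ∪ B, A, B and one at 𝟎 that depends
-- on neither A nor B.  After rescaling, D thus contains the affine parallelogram
-- relations (A ∪ B) - A - B + 𝟎, as does the space of affine dependencies of the cube.
-- In both spaces the facets make 𝟎 and the singletons independent, and modulo the
-- parallelograms everything is supported there, so the two spaces agree.

open import Defs
open import Level using (0ℓ)
open import Data.Bool.Base using (true; false; if_then_else_)
open import Data.Empty using (⊥-elim)
open import Data.Fin.Base as Fin using (Fin)
import Data.Fin.Properties as Fin
open import Data.Fin.Subset as Subset using (Subset; Nonempty; Empty; ⁅_⁆; ⊤)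
  renaming (_∈_ to _∈ˢ_; _∉_ to _∉ˢ_)
import Data.Fin.Subset.Properties as Subset
open import Data.List.Base as List using (List; length)
open import Data.List.Membership.Propositional using () renaming (_∈_ to _∈ˡ_)
open import Data.List.Membership.Propositional.Properties
  using (∈-++⁺ˡ; ∈-++⁺ʳ; ∈-map⁺; ∈-filter⁺)
open import Data.List.Properties using (filter-notAll)
open import Data.List.Relation.Unary.Any as Any using (here; there)
open import Data.Maybe.Base using (Maybe; just; nothing)
open import Data.Nat.Base using (ℕ; zero; suc; _≤_; s≤s) renaming (_<_ to _<ⁿ_)
import Data.Nat.Properties as ℕ
open import Data.Product.Base using (Σ-syntax; ∃-syntax; _×_; _,_; proj₁; proj₂)
open import Data.Sign.Base as Sign using (Sign)
import Data.Sign.Properties as Sign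
open import Data.Sum.Base as Sum using (_⊎_; inj₁; inj₂)
open import Data.Vec.Base as Vec using ([]; _∷_; lookup; replicate; updateAt)
open import Data.Vec.Properties
  using (≡-dec; lookup-replicate; lookup∘updateAt; lookup∘updateAt′; lookup-zipWith;
          lookup⇒[]=; []=⇒lookup)
open import Function.Base using (_∘_; case_of_)
open import Function.Bundles using (_⇔_; mk⇔; module Equivalence)
open import Function.Construct.Identity using (↔-id)
open import Relation.Binary.Definitions using (DecidableEquality; tri<; tri≈; tri>)
open import Relation.Binary.PropositionalEquality.Core as ≡ using (_≡_; _≢_)
open import Relation.Binary.Structures using (IsStrictTotalOrder)
open import Relation.Nullary using (¬_; does; yes; no; contradiction)
open import Relation.Nullary.Decidable using (¬?)
open import Relation.Unary using (Pred; _∈_; _⊆_; _≐_; ∁)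
import Algebra.Solver.Ring.NaturalCoefficients.Default as SemiringSolver

-- Vertex lists and orthogonality of signed sets.

infix 4 _≟ᵛ_

_≟ᵛ_ : ∀ {n} → DecidableEquality (C n)
_≟ᵛ_ = ≡-dec Sign._≟_

vertices : ∀ n → List (C n)
vertices zero    = List.[ [] ]
vertices (suc n) = List.map (Sign.+ ∷_) (vertices n) List.++ List.map (Sign.- ∷_) (vertices n)

∈-vertices : ∀ {n} (v : C n) → v ∈ˡ vertices n
∈-vertices []                 = here ≡.refl
∈-vertices (Sign.+ ∷ v)       = ∈-++⁺ˡ (∈-map⁺ (Sign.+ ∷_) (∈-vertices v))
∈-vertices {suc n} (Sign.- ∷ v) =
  ∈-++⁺ʳ (List.map (Sign.+ ∷_) (vertices n)) (∈-map⁺ (Sign.- ∷_) (∈-vertices v))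

remove : ∀ {n} → C n → List (C n) → List (C n)
remove f = List.filter (λ w → ¬? (w ≟ᵛ f))

length-remove : ∀ {n} {f : C n} {xs} → f ∈ˡ xs → length (remove f xs) <ⁿ length xs
length-remove {f = f} {xs} f∈xs =
  filter-notAll (λ w → ¬? (w ≟ᵛ f)) xs (Any.map (λ f≡w w≢f → w≢f (≡.sym f≡w)) f∈xs)

-- Orthogonality pairs every agreement of signs with a disagreement and conversely. Whichever of the
-- two occurs at `e`, the witness of the other must be a different element, since a sign cannot take
-- two values at once.
meet-twice : ∀ {E : Set} {X Y : SignedSet E} {e} → X ⊥ Y → e ∈ supp X → e ∈ supp Y →
             ∃[ f ] f ≢ e × f ∈ supp X × f ∈ supp Y
meet-twice {X = X} {Y} {e} X⊥Y e∈X e∈Y = go (X e) (Y e) ≡.refl ≡.refl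
  where
  open Equivalence X⊥Y
  in-supp : ∀ {Z : Maybe Sign} {s} → Z ≡ just s → Z ≢ nothing
  in-supp ≡.refl ()
  clash : ∀ {Z : Maybe Sign} {s t} → s ≢ t → Z ≡ just s → Z ≢ just t
  clash s≢t ≡.refl ≡.refl = s≢t ≡.refl
  away : ∀ {f s t s′ t′} → X e ≡ just s → Y e ≡ just t → X f ≡ just s′ × Y f ≡ just t′ →
         s ≢ s′ ⊎ t ≢ t′ → ∃[ f ] f ≢ e × f ∈ supp X × f ∈ supp Y
  away {f} p q (p′ , q′) differ =
    f , (λ { ≡.refl → Sum.[ (λ d → clash d p p′) , (λ d → clash d q q′) ] differ }) ,
    in-supp p′ , in-supp q′
  go : ∀ σ τ → X e ≡ σ → Y e ≡ τ → ∃[ f ] f ≢ e × f ∈ supp X × f ∈ supp Y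
  go nothing _ p q = contradiction p e∈X
  go _ nothing p q = contradiction q e∈Y
  go (just Sign.+) (just Sign.+) p q with to (e , inj₁ (p , q))
  ... | f , inj₁ r = away p q r (inj₂ λ ())
  ... | f , inj₂ r = away p q r (inj₁ λ ())
  go (just Sign.-) (just Sign.-) p q with to (e , inj₂ (p , q))
  ... | f , inj₁ r = away p q r (inj₁ λ ())
  ... | f , inj₂ r = away p q r (inj₂ λ ())
  go (just Sign.+) (just Sign.-) p q with from (e , inj₁ (p , q))
  ... | f , inj₁ r = away p q r (inj₂ λ ())
  ... | f , inj₂ r = away p q r (inj₁ λ ())
  go (just Sign.-) (just Sign.+) p q with from (e , inj₂ (p , q))
  ... | f , inj₁ r = away p q r (inj₁ λ ())
  ... | f , inj₂ r = away p q r (inj₂ λ ())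

-- Vertices as subsets of the coordinates.

𝟎 : ∀ {n} → C n
𝟎 = replicate _ Sign.+

lookup-𝟎 : ∀ {n} (i : Fin n) → lookup 𝟎 i ≡ Sign.+
lookup-𝟎 i = lookup-replicate i Sign.+

at : ∀ {n} → Subset n → C n
at A = flip A 𝟎

lookup-at : ∀ {n} (A : Subset n) i →
            lookup (at A) i ≡ (if lookup A i then Sign.- else Sign.+)
lookup-at A i = ≡.trans (lookup-zipWith _ i A 𝟎)
  (≡.cong (λ s → if lookup A i then Sign.opposite s else s) (lookup-𝟎 i))

lookup-at-∈ : ∀ {n} {A : Subset n} {i} → i ∈ˢ A → lookup (at A) i ≡ Sign.-
lookup-at-∈ {A = A} {i} i∈A =
  ≡.trans (lookup-at A i) (≡.cong (λ b → if b then Sign.- else Sign.+) ([]=⇒lookup i∈A))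

lookup-at-∉ : ∀ {n} {A : Subset n} {i} → i ∉ˢ A → lookup (at A) i ≡ Sign.+
lookup-at-∉ {A = A} {i} i∉A with lookup A i in eq | lookup-at A i
... | true  | _ = contradiction (lookup⇒[]= i A eq) i∉A
... | false | p = p

lookup-at⁻ : ∀ {n} {A : Subset n} {i} → lookup (at A) i ≡ Sign.- → i ∈ˢ A
lookup-at⁻ {A = A} {i} p with i Subset.∈? A
... | yes i∈A = i∈A
... | no  i∉A = case ≡.trans (≡.sym p) (lookup-at-∉ i∉A) of λ ()

minuses : ∀ {n} → C n → Subset n
minuses = Vec.map λ { Sign.+ → false ; Sign.- → true }

at-minuses : ∀ {n} (v : C n) → at (minuses v) ≡ v
at-minuses []           = ≡.refl
at-minuses (Sign.+ ∷ v) = ≡.cong (Sign.+ ∷_) (at-minuses v)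
at-minuses (Sign.- ∷ v) = ≡.cong (Sign.- ∷_) (at-minuses v)

at-⊥ : ∀ {n} → at (Subset.⊥ {n}) ≡ 𝟎
at-⊥ {zero}  = ≡.refl
at-⊥ {suc n} = ≡.cong (Sign.+ ∷_) at-⊥

separated : ∀ {n} {v w : C n} i → lookup v i ≡ Sign.- → lookup w i ≡ Sign.+ → v ≢ w
separated i p q ≡.refl = case ≡.trans (≡.sym p) q of λ ()

-- Disjoint nonempty pairs and the rectangles through `𝟎`.

record Splits {n} (A B : Subset n) : Set where
  field
    A≢∅      : Nonempty A
    B≢∅      : Nonempty B
    disjoint : Empty (A Subset.∩ B)

  A∌ : ∀ {i} → i ∈ˢ B → i ∉ˢ A
  A∌ i∈B i∈A = disjoint (_ , Subset.x∈p∩q⁺ (i∈A , i∈B))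

  B∌ : ∀ {i} → i ∈ˢ A → i ∉ˢ B
  B∌ i∈A i∈B = disjoint (_ , Subset.x∈p∩q⁺ (i∈A , i∈B))

  AB⊇A : ∀ {i} → i ∈ˢ A → i ∈ˢ A Subset.∪ B
  AB⊇A i∈A = Subset.x∈p∪q⁺ (inj₁ i∈A)

  AB⊇B : ∀ {i} → i ∈ˢ B → i ∈ˢ A Subset.∪ B
  AB⊇B i∈B = Subset.x∈p∪q⁺ (inj₂ i∈B)

  AB≢A : at (A Subset.∪ B) ≢ at A
  AB≢A = let j , j∈B = B≢∅ in separated j (lookup-at-∈ (AB⊇B j∈B)) (lookup-at-∉ (A∌ j∈B))

  AB≢B : at (A Subset.∪ B) ≢ at B
  AB≢B = let i , i∈A = A≢∅ in separated i (lookup-at-∈ (AB⊇A i∈A)) (lookup-at-∉ (B∌ i∈A))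

  AB≢𝟎 : at (A Subset.∪ B) ≢ 𝟎
  AB≢𝟎 = let i , i∈A = A≢∅ in separated i (lookup-at-∈ (AB⊇A i∈A)) (lookup-𝟎 i)

  A≢B : at A ≢ at B
  A≢B = let i , i∈A = A≢∅ in separated i (lookup-at-∈ i∈A) (lookup-at-∉ (B∌ i∈A))

  A≢𝟎 : at A ≢ 𝟎
  A≢𝟎 = let i , i∈A = A≢∅ in separated i (lookup-at-∈ i∈A) (lookup-𝟎 i)

  B≢𝟎 : at B ≢ 𝟎
  B≢𝟎 = let i , i∈B = B≢∅ in separated i (lookup-at-∈ i∈B) (lookup-𝟎 i)

Splits-sym : ∀ {n} {A B : Subset n} → Splits A B → Splits B A
Splits-sym {A = A} {B} sp = record
  { A≢∅ = B≢∅ ; B≢∅ = A≢∅ ; disjoint = ≡.subst Empty (Subset.∩-comm A B) disjoint }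
  where open Splits sp

Splits-∁ : ∀ {n} {A : Subset n} → Nonempty A → Nonempty (Subset.∁ A) → Splits A (Subset.∁ A)
Splits-∁ {A = A} A≢∅ ∁A≢∅ = record
  { A≢∅ = A≢∅ ; B≢∅ = ∁A≢∅
  ; disjoint = λ { (i , i∈) → let i∈A , i∈∁A = Subset.x∈p∩q⁻ A _ i∈ in Subset.x∈∁p⇒x∉p i∈∁A i∈A } }

Splits-⁅⁆ : ∀ {n} {i : Fin n} {B} → i ∉ˢ B → Nonempty B → Splits ⁅ i ⁆ B
Splits-⁅⁆ {i = i} {B} i∉B B≢∅ = record
  { A≢∅ = i , Subset.x∈⁅x⁆ i ; B≢∅ = B≢∅
  ; disjoint = λ { (j , j∈) → let j∈i , j∈B = Subset.x∈p∩q⁻ ⁅ i ⁆ B j∈ in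
      i∉B (≡.subst (_∈ˢ B) (Subset.x∈⁅y⁆⇒x≡y i j∈i) j∈B) } }

∈-∁⁅⁆ : ∀ {n} {A B : Subset n} {i j} → Splits A B → i ∈ˢ A → j ∈ˢ B → j ∈ˢ Subset.∁ ⁅ i ⁆
∈-∁⁅⁆ {B = B} {i} sp i∈A j∈B = Subset.x∉p⇒x∈∁p λ j∈i →
  Splits.B∌ sp i∈A (≡.subst (_∈ˢ B) (Subset.x∈⁅y⁆⇒x≡y i j∈i) j∈B)

data Corner {n} (A B : Subset n) (w : C n) : Set where
  is-AB : at (A Subset.∪ B) ≡ w → Corner A B w
  is-A  : at A ≡ w → Corner A B w
  is-B  : at B ≡ w → Corner A B w
  is-𝟎  : 𝟎 ≡ w → Corner A B w
  other : at (A Subset.∪ B) ≢ w → at A ≢ w → at B ≢ w → 𝟎 ≢ w → Corner A B w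

corner? : ∀ {n} (A B : Subset n) w → Corner A B w
corner? A B w with at (A Subset.∪ B) ≟ᵛ w | at A ≟ᵛ w | at B ≟ᵛ w | 𝟎 ≟ᵛ w
... | yes p | _     | _     | _     = is-AB p
... | no  _ | yes q | _     | _     = is-A q
... | no  _ | no  _ | yes r | _     = is-B r
... | no  _ | no  _ | no  _ | yes s = is-𝟎 s
... | no  p | no  q | no  r | no  s = other p q r s

-- The corners are tested in a fixed order, so this is defined even when some of them coincide.
-- `Splits` makes the four corners distinct, which is why the evaluation lemmas ask for it.
rectangle : ∀ {n} → Subset n → Subset n → SignedSet (C n)
rectangle A B w with corner? A B w
... | is-AB _       = just Sign.+
... | is-A _        = just Sign.-
... | is-B _        = just Sign.-
... | is-𝟎 _        = just Sign.+
... | other _ _ _ _ = nothing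

module _ {n} {A B : Subset n} (sp : Splits A B) where
  open Splits sp

  rectangle-AB : rectangle A B (at (A Subset.∪ B)) ≡ just Sign.+
  rectangle-AB with corner? A B (at (A Subset.∪ B))
  ... | is-AB _       = ≡.refl
  ... | is-A p        = contradiction (≡.sym p) AB≢A
  ... | is-B p        = contradiction (≡.sym p) AB≢B
  ... | is-𝟎 _        = ≡.refl
  ... | other p _ _ _ = contradiction ≡.refl p

  rectangle-A : rectangle A B (at A) ≡ just Sign.-
  rectangle-A with corner? A B (at A)
  ... | is-AB p       = contradiction p AB≢A
  ... | is-A _        = ≡.refl
  ... | is-B _        = ≡.refl
  ... | is-𝟎 p        = contradiction (≡.sym p) A≢𝟎
  ... | other _ p _ _ = contradiction ≡.refl p

  rectangle-B : rectangle A B (at B) ≡ just Sign.-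
  rectangle-B with corner? A B (at B)
  ... | is-AB p       = contradiction p AB≢B
  ... | is-A _        = ≡.refl
  ... | is-B _        = ≡.refl
  ... | is-𝟎 p        = contradiction (≡.sym p) B≢𝟎
  ... | other _ _ p _ = contradiction ≡.refl p

  rectangle-𝟎 : rectangle A B 𝟎 ≡ just Sign.+
  rectangle-𝟎 with corner? A B 𝟎
  ... | is-AB _       = ≡.refl
  ... | is-A p        = contradiction p A≢𝟎
  ... | is-B p        = contradiction p B≢𝟎
  ... | is-𝟎 _        = ≡.refl
  ... | other _ _ _ p = contradiction ≡.refl p

  rectangle-other : ∀ w → at (A Subset.∪ B) ≢ w → at A ≢ w → at B ≢ w → 𝟎 ≢ w →
                    rectangle A B w ≡ nothing
  rectangle-other w p q r s with corner? A B w
  ... | is-AB p′      = contradiction p′ p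
  ... | is-A q′       = contradiction q′ q
  ... | is-B r′       = contradiction r′ r
  ... | is-𝟎 s′       = contradiction s′ s
  ... | other _ _ _ _ = ≡.refl

  rectangle-isSignedRectangle : IsSignedRectangle (rectangle A B)
  rectangle-isSignedRectangle = record
    { v = 𝟎 ; A = A ; B = B ; A≢∅ = A≢∅ ; B≢∅ = B≢∅ ; disjoint = disjoint
    ; positive = positive , λ { (inj₁ ≡.refl) → rectangle-𝟎 ; (inj₂ ≡.refl) → rectangle-AB }
    ; negative = negative , λ { (inj₁ ≡.refl) → rectangle-A ; (inj₂ ≡.refl) → rectangle-B }
    }
    where
    positive : ∀ {w} → rectangle A B w ≡ just Sign.+ → 𝟎 ≡ w ⊎ at (A Subset.∪ B) ≡ w
    positive {w} h with corner? A B w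
    positive h | is-AB p = inj₂ p
    positive h | is-𝟎 p  = inj₁ p
    positive () | is-A _
    positive () | is-B _
    positive () | other _ _ _ _
    negative : ∀ {w} → rectangle A B w ≡ just Sign.- → at A ≡ w ⊎ at B ≡ w
    negative {w} h with corner? A B w
    negative h | is-A p = inj₁ p
    negative h | is-B p = inj₂ p
    negative () | is-AB _
    negative () | is-𝟎 _
    negative () | other _ _ _ _

module Proof (ℝ : Reals) where
  open Reals ℝ hiding (zero)
  open IsStrictTotalOrder isStrictTotalOrder
    using (compare; _≟_; irrefl; <-respʳ-≈; <-respˡ-≈) renaming (trans to <-trans)
  open import Algebra.Properties.Ring ring
    using (-‿distribˡ-*; -‿distribʳ-*; -1*x≈-x; -‿involutive; +-inverseˡ-unique)
  open import Relation.Binary.Reasoning.Setoid setoid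
  open SemiringSolver commutativeSemiring using (solve; _:=_; _:+_; _:*_; con)

  -- Arithmetic in an ordered field.

  pos⇒≉0 : ∀ {x} → 0# < x → ¬ (x ≈ 0#)
  pos⇒≉0 0<x x≈0 = irrefl (sym x≈0) 0<x

  neg⇒≉0 : ∀ {x} → x < 0# → ¬ (x ≈ 0#)
  neg⇒≉0 x<0 x≈0 = irrefl x≈0 x<0

  pos-+ : ∀ {x y} → 0# < x → 0# < y → 0# < x + y
  pos-+ {x} 0<x 0<y = <-trans 0<x (<-respˡ-≈ (+-identityʳ x) (+-monoʳ-< x 0<y))

  -‿pos : ∀ {x} → 0# < x → - x < 0#
  -‿pos {x} 0<x = <-respʳ-≈ (-‿inverseˡ x) (<-respˡ-≈ (+-identityʳ (- x)) (+-monoʳ-< (- x) 0<x))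

  -‿neg : ∀ {x} → x < 0# → 0# < - x
  -‿neg {x} x<0 = <-respˡ-≈ (-‿inverseˡ x) (<-respʳ-≈ (+-identityʳ (- x)) (+-monoʳ-< (- x) x<0))

  pos*neg : ∀ {x y} → 0# < x → y < 0# → x * y < 0#
  pos*neg {x} {y} 0<x y<0 = <-respˡ-≈ (trans (-‿cong (sym (-‿distribʳ-* x y))) (-‿involutive _))
    (-‿pos (*-pos 0<x (-‿neg y<0)))

  neg*pos : ∀ {x y} → x < 0# → 0# < y → x * y < 0#
  neg*pos x<0 0<y = <-respˡ-≈ (*-comm _ _) (pos*neg 0<y x<0)

  neg*neg : ∀ {x y} → x < 0# → y < 0# → 0# < x * y
  neg*neg {x} {y} x<0 y<0 = <-respʳ-≈ (trans (-‿distribʳ-* x (- y)) (*-congˡ (-‿involutive y)))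
    (-‿neg (neg*pos x<0 (-‿neg y<0)))

  reciprocal : ∀ {x} → 0# < x → ∃[ y ] 0# < y × x * y ≈ 1#
  reciprocal {x} 0<x with inverse x (pos⇒≉0 0<x)
  ... | y , xy≈1 with compare 0# y
  ...   | tri< 0<y _ _ = y , 0<y , xy≈1
  ...   | tri≈ _ 0≈y _ =
    ⊥-elim (irrefl (trans (sym (zeroʳ x)) (trans (*-congˡ 0≈y) xy≈1)) 0<1)
  ...   | tri> _ _ y<0 = ⊥-elim (irrefl refl (<-trans 0<1 (<-respˡ-≈ xy≈1 (pos*neg 0<x y<0))))

  x*y≈0⇒y≈0 : ∀ {x y} → ¬ (x ≈ 0#) → x * y ≈ 0# → y ≈ 0#
  x*y≈0⇒y≈0 {x} {y} x≉0 xy≈0 with inverse x x≉0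
  ... | z , xz≈1 = begin
    y            ≈⟨ *-identityˡ y ⟨
    1# * y       ≈⟨ *-congʳ xz≈1 ⟨
    (x * z) * y  ≈⟨ solve 3 (λ x y z → (x :* z) :* y := z :* (x :* y)) refl x y z ⟩
    z * (x * y)  ≈⟨ *-congˡ xy≈0 ⟩
    z * 0#       ≈⟨ zeroʳ z ⟩
    0#           ∎

  *-cancelˡ : ∀ {x y z} → ¬ (x ≈ 0#) → x * y ≈ x * z → y ≈ z
  *-cancelˡ {x} {y} {z} x≉0 xy≈xz with inverse x x≉0
  ... | x⁻¹ , xx⁻¹≈1 = trans (sym (undo y)) (trans (*-congˡ xy≈xz) (undo z))
    where
    undo : ∀ u → x⁻¹ * (x * u) ≈ u
    undo u = trans (solve 3 (λ x y u → y :* (x :* u) := (x :* y) :* u) refl x x⁻¹ u)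
                   (trans (*-congʳ xx⁻¹≈1) (*-identityˡ u))

  x+-1x≈0 : ∀ x → x + - 1# * x ≈ 0#
  x+-1x≈0 x = trans (+-congˡ (-1*x≈-x x)) (-‿inverseʳ x)

  x+-1y≈0⇒x≈y : ∀ {x y} → x + - 1# * y ≈ 0# → x ≈ y
  x+-1y≈0⇒x≈y {x} {y} p = begin
    x                    ≈⟨ +-inverseˡ-unique x (- 1# * y) p ⟩
    - (- 1# * y)         ≈⟨ -‿cong (-1*x≈-x y) ⟩
    - (- y)              ≈⟨ -‿involutive y ⟩
    y                    ∎

  0+c*0≈0 : ∀ c {x y} → x ≈ 0# → y ≈ 0# → x + c * y ≈ 0#
  0+c*0≈0 c x≈0 y≈0 = trans (+-cong x≈0 (trans (*-congˡ y≈0) (zeroʳ c))) (+-identityʳ 0#)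

  x+c*0≈x : ∀ c {x y} → y ≈ 0# → x + c * y ≈ x
  x+c*0≈x c y≈0 = trans (+-congˡ (trans (*-congˡ y≈0) (zeroʳ c))) (+-identityʳ _)

  -- Trichotomy makes equality decidable; this is what licenses the later proofs of vanishing by
  -- contradiction.
  ≈0-stable : ∀ {x} → ¬ ¬ (x ≈ 0#) → x ≈ 0#
  ≈0-stable {x} ¬¬p with x ≟ 0#
  ... | yes p = p
  ... | no ¬p = ⊥-elim (¬¬p ¬p)

  -- Signs of field elements.

  signOf : Carrier → Maybe Sign
  signOf x with compare 0# x
  ... | tri< _ _ _ = just Sign.+
  ... | tri≈ _ _ _ = nothing
  ... | tri> _ _ _ = just Sign.-

  signOf-hasSign : ∀ x → HasSign ℝ (signOf x) x
  signOf-hasSign x with compare 0# x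
  ... | tri< 0<x _ _ = 0<x
  ... | tri≈ _ 0≈x _ = sym 0≈x
  ... | tri> _ _ x<0 = x<0

  hasSign⇒≉0 : ∀ {σ x} → HasSign ℝ σ x → σ ≢ nothing → ¬ (x ≈ 0#)
  hasSign⇒≉0 {just Sign.+} h _ = pos⇒≉0 h
  hasSign⇒≉0 {just Sign.-} h _ = neg⇒≉0 h
  hasSign⇒≉0 {nothing}     h q = ⊥-elim (q ≡.refl)

  ≉0⇒hasSign : ∀ {σ x} → HasSign ℝ σ x → ¬ (x ≈ 0#) → σ ≢ nothing
  ≉0⇒hasSign h x≉0 ≡.refl = x≉0 h

  hasSign-scale : ∀ {σ c x} → 0# < c → HasSign ℝ σ x → HasSign ℝ σ (c * x)
  hasSign-scale {just Sign.+} 0<c h = *-pos 0<c h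
  hasSign-scale {just Sign.-} 0<c h = pos*neg 0<c h
  hasSign-scale {nothing} {c} 0<c h = trans (*-congˡ h) (zeroʳ c)

  hasSign-pos : ∀ {σ τ x y} → HasSign ℝ σ x → HasSign ℝ τ y → 0# < x * y →
                (σ ≡ just Sign.+ × τ ≡ just Sign.+) ⊎ (σ ≡ just Sign.- × τ ≡ just Sign.-)
  hasSign-pos {just Sign.+} {just Sign.+} h k p = inj₁ (≡.refl , ≡.refl)
  hasSign-pos {just Sign.-} {just Sign.-} h k p = inj₂ (≡.refl , ≡.refl)
  hasSign-pos {just Sign.+} {just Sign.-} h k p = ⊥-elim (irrefl refl (<-trans p (pos*neg h k)))
  hasSign-pos {just Sign.-} {just Sign.+} h k p = ⊥-elim (irrefl refl (<-trans p (neg*pos h k)))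
  hasSign-pos {nothing} {_} {y = y} h k p = ⊥-elim (pos⇒≉0 p (trans (*-congʳ h) (zeroˡ y)))
  hasSign-pos {just _} {nothing} {x} h k p = ⊥-elim (pos⇒≉0 p (trans (*-congˡ k) (zeroʳ x)))

  hasSign-neg : ∀ {σ τ x y} → HasSign ℝ σ x → HasSign ℝ τ y → x * y < 0# →
                (σ ≡ just Sign.+ × τ ≡ just Sign.-) ⊎ (σ ≡ just Sign.- × τ ≡ just Sign.+)
  hasSign-neg {just Sign.+} {just Sign.-} h k p = inj₁ (≡.refl , ≡.refl)
  hasSign-neg {just Sign.-} {just Sign.+} h k p = inj₂ (≡.refl , ≡.refl)
  hasSign-neg {just Sign.+} {just Sign.+} h k p = ⊥-elim (irrefl refl (<-trans p (*-pos h k)))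
  hasSign-neg {just Sign.-} {just Sign.-} h k p = ⊥-elim (irrefl refl (<-trans p (neg*neg h k)))
  hasSign-neg {nothing} {_} {y = y} h k p = ⊥-elim (neg⇒≉0 p (trans (*-congʳ h) (zeroˡ y)))
  hasSign-neg {just _} {nothing} {x} h k p = ⊥-elim (neg⇒≉0 p (trans (*-congˡ k) (zeroʳ x)))

  -- Sums over the cube and orthogonality of sign patterns.

  δ : ∀ {n} → C n → C n → Carrier
  δ a w = if does (a ≟ᵛ w) then 1# else 0#

  δ-≡ : ∀ {n} {a w : C n} → a ≡ w → δ a w ≈ 1#
  δ-≡ {a = a} {w} a≡w with a ≟ᵛ w
  ... | yes _   = refl
  ... | no  a≢w = contradiction a≡w a≢w

  δ-≢ : ∀ {n} {a w : C n} → a ≢ w → δ a w ≈ 0#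
  δ-≢ {a = a} {w} a≢w with a ≟ᵛ w
  ... | yes a≡w = contradiction a≡w a≢w
  ... | no  _   = refl

  ∑-cong : ∀ n {f g : C n → Carrier} → (∀ v → f v ≈ g v) → ∑ ℝ n f ≈ ∑ ℝ n g
  ∑-cong zero    f≈g = f≈g []
  ∑-cong (suc n) f≈g = +-cong (∑-cong n (f≈g ∘ (Sign.+ ∷_))) (∑-cong n (f≈g ∘ (Sign.- ∷_)))

  ∑-zero : ∀ n {f : C n → Carrier} → (∀ v → f v ≈ 0#) → ∑ ℝ n f ≈ 0#
  ∑-zero zero    f≈0 = f≈0 []
  ∑-zero (suc n) f≈0 = trans (+-cong (∑-zero n (f≈0 ∘ _)) (∑-zero n (f≈0 ∘ _))) (+-identityʳ 0#)

  ∑-axpy : ∀ n (f : C n → Carrier) c (g : C n → Carrier) → ∑ ℝ n (λ v → f v + c * g v) ≈ ∑ ℝ n f + c * ∑ ℝ n g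
  ∑-axpy zero    f c g = refl
  ∑-axpy (suc n) f c g = trans (+-cong (∑-axpy n _ c _) (∑-axpy n _ c _))
    (solve 5 (λ a b c d e → (a :+ e :* b) :+ (c :+ e :* d) := (a :+ c) :+ e :* (b :+ d)) refl
      _ _ _ _ c)

  ∑-axpy-* : ∀ n (f : C n → Carrier) c (g h : C n → Carrier) →
             ∑ ℝ n (λ v → (f v + c * g v) * h v) ≈
             ∑ ℝ n (λ v → f v * h v) + c * ∑ ℝ n (λ v → g v * h v)
  ∑-axpy-* n f c g h = trans
    (∑-cong n (λ v → solve 4 (λ f c g h → (f :+ c :* g) :* h := f :* h :+ c :* (g :* h)) refl
      (f v) c (g v) (h v)))
    (∑-axpy n _ c _)

  ∑-δ : ∀ n (a : C n) (h : C n → Carrier) → ∑ ℝ n (λ v → δ a v * h v) ≈ h a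
  ∑-δ zero    []           h = *-identityˡ (h [])
  ∑-δ (suc n) (Sign.+ ∷ a) h = trans
    (+-cong (∑-δ n a (h ∘ (Sign.+ ∷_))) (∑-zero n (λ v → zeroˡ (h (Sign.- ∷ v))))) (+-identityʳ _)
  ∑-δ (suc n) (Sign.- ∷ a) h = trans
    (+-cong (∑-zero n (λ v → zeroˡ (h (Sign.+ ∷ v)))) (∑-δ n a (h ∘ (Sign.- ∷_)))) (+-identityˡ _)

  -- Phrased as a search through the cube, so that the first case delivers an actual vertex:
  -- orthogonality of signed sets asks for explicit witnesses.
  ∑-sign : ∀ n (f : C n → Carrier) →
           (∃[ v ] f v < 0#) ⊎ (∀ v → f v ≈ 0#) ⊎ 0# < ∑ ℝ n f
  ∑-sign zero f with compare 0# (f [])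
  ... | tri< 0<f _ _ = inj₂ (inj₂ 0<f)
  ... | tri≈ _ 0≈f _ = inj₂ (inj₁ λ { [] → sym 0≈f })
  ... | tri> _ _ f<0 = inj₁ ([] , f<0)
  ∑-sign (suc n) f with ∑-sign n (f ∘ (Sign.+ ∷_)) | ∑-sign n (f ∘ (Sign.- ∷_))
  ... | inj₁ (v , f<0) | _ = inj₁ (_ , f<0)
  ... | inj₂ _ | inj₁ (v , f<0) = inj₁ (_ , f<0)
  ... | inj₂ (inj₁ p) | inj₂ (inj₁ q) = inj₂ (inj₁ λ { (Sign.+ ∷ v) → p v ; (Sign.- ∷ v) → q v })
  ... | inj₂ (inj₁ p) | inj₂ (inj₂ q) =
    inj₂ (inj₂ (<-respʳ-≈ (sym (trans (+-congʳ (∑-zero n p)) (+-identityˡ _))) q))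
  ... | inj₂ (inj₂ p) | inj₂ (inj₁ q) =
    inj₂ (inj₂ (<-respʳ-≈ (sym (trans (+-congˡ (∑-zero n q)) (+-identityʳ _))) p))
  ... | inj₂ (inj₂ p) | inj₂ (inj₂ q) = inj₂ (inj₂ (pos-+ p q))

  ∑≈0⇒neg : ∀ {n} {f : C n → Carrier} → ∑ ℝ n f ≈ 0# → ∃[ v ] 0# < f v → ∃[ v ] f v < 0#
  ∑≈0⇒neg {n} {f} ∑≈0 (v , 0<fv) with ∑-sign n f
  ... | inj₁ p        = p
  ... | inj₂ (inj₁ p) = ⊥-elim (pos⇒≉0 0<fv (p v))
  ... | inj₂ (inj₂ p) = ⊥-elim (pos⇒≉0 p ∑≈0)

  ∑≈0⇒pos : ∀ {n} {f : C n → Carrier} → ∑ ℝ n f ≈ 0# → ∃[ v ] f v < 0# → ∃[ v ] 0# < f v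
  ∑≈0⇒pos {n} {f} ∑≈0 (v , fv<0)
    -- The negative of `f`, written as `0# + - 1# * f v` to fit `∑-axpy`.
    with ∑≈0⇒neg {f = λ v → 0# + - 1# * f v}
           (trans (∑-axpy n (λ _ → 0#) (- 1#) f) (0+c*0≈0 _ (∑-zero n λ _ → refl) ∑≈0))
           (v , <-respʳ-≈ (sym (trans (+-identityˡ _) (-1*x≈-x _))) (-‿neg fv<0))
  ... | w , p = w , <-respʳ-≈ (-‿involutive _) (-‿neg (<-respˡ-≈ (trans (+-identityˡ _) (-1*x≈-x _)) p))

  -- The product `x v * y v` is positive where the signs agree and negative where they differ. A
  -- vanishing sum with a term of one kind also has a term of the other.
  ∑≈0⇒⊥ : ∀ {n} {X Y : SignedSet (C n)} (x y : C n → Carrier) →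
          (∀ v → HasSign ℝ (X v) (x v)) → (∀ v → HasSign ℝ (Y v) (y v)) →
          ∑ ℝ n (λ v → x v * y v) ≈ 0# → X ⊥ Y
  ∑≈0⇒⊥ {n} {X} {Y} x y hx hy ∑≈0 = mk⇔
    (λ { (e , p) → case ∑≈0⇒neg ∑≈0 (e , agree p) of λ { (f , q) → f , hasSign-neg (hx f) (hy f) q } })
    (λ { (e , p) → case ∑≈0⇒pos ∑≈0 (e , differ p) of λ { (f , q) → f , hasSign-pos (hx f) (hy f) q } })
    where
    agree : ∀ {e} → (X e ≡ just Sign.+ × Y e ≡ just Sign.+) ⊎ (X e ≡ just Sign.- × Y e ≡ just Sign.-) →
            0# < x e * y e
    agree {e} p with X e | Y e | hx e | hy e
    agree (inj₁ (≡.refl , ≡.refl)) | _ | _ | h | k = *-pos h k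
    agree (inj₂ (≡.refl , ≡.refl)) | _ | _ | h | k = neg*neg h k
    differ : ∀ {e} → (X e ≡ just Sign.+ × Y e ≡ just Sign.-) ⊎ (X e ≡ just Sign.- × Y e ≡ just Sign.+) →
             x e * y e < 0#
    differ {e} p with X e | Y e | hx e | hy e
    differ (inj₁ (≡.refl , ≡.refl)) | _ | _ | h | k = pos*neg h k
    differ (inj₂ (≡.refl , ≡.refl)) | _ | _ | h | k = neg*pos h k

  -- Spaces of dependencies and elimination inside them.

  record IsSubspace {n} (D : Pred (C n → Carrier) 0ℓ) : Set where
    field
      resp : ∀ {x y} → (∀ v → x v ≈ y v) → D x → D y
      origin : D (λ _ → 0#)
      axpy : ∀ c {x y} → D x → D y → D (λ v → x v + c * y v)

    scale : ∀ c {x} → D x → D (λ v → c * x v)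
    scale c Dx = resp (λ v → +-identityˡ _) (axpy c origin Dx)

  linearDependency-isSubspace : ∀ {n d} (p : C n → Fin d → Carrier) → IsSubspace (LinearDependency ℝ p)
  linearDependency-isSubspace {n} p = record
    { resp = λ x≈y Dx k → trans (∑-cong n (λ v → *-congʳ (sym (x≈y v)))) (Dx k)
    ; origin = λ k → ∑-zero n (λ v → zeroˡ _)
    ; axpy = λ c {x} {y} Dx Dy k → trans (∑-axpy-* n x c y (λ v → p v k)) (0+c*0≈0 c (Dx k) (Dy k))
    }

  affineDependency-isSubspace : ∀ {n d} (p : C n → Fin d → Carrier) → IsSubspace (AffineDependency ℝ p)
  affineDependency-isSubspace {n} p = record
    { resp = λ x≈y (∑x , Dx) → trans (∑-cong n (λ v → sym (x≈y v))) ∑x , Lin.resp x≈y Dx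
    ; origin = ∑-zero n (λ _ → refl) , Lin.origin
    ; axpy = λ c {x} {y} (∑x , Dx) (∑y , Dy) →
               trans (∑-axpy n x c y) (0+c*0≈0 c ∑x ∑y) , Lin.axpy c {x} {y} Dx Dy
    }
    where module Lin = IsSubspace (linearDependency-isSubspace p)

  module _ {n} {D : Pred (C n → Carrier) 0ℓ} (D-sub : IsSubspace D) {Y : SignedSet (C n)}
           (⊥Y : ∀ X → IsMinimalDependency ℝ D X → X ⊥ Y) {e : C n} (e∈Y : e ∈ supp Y) where
    open IsSubspace D-sub

    -- Any dependency through e can be shrunk to a minimal one through e, and the
    -- sign vector of the latter would meet Y in e alone.
    vanishes-at-lone : ∀ {x} → D x → (∀ w → w ∈ supp Y → w ≢ e → x w ≈ 0#) → x e ≈ 0#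
    vanishes-at-lone {x} Dx lone = ≈0-stable λ xe≉0 →
      go _ (vertices n) ℕ.≤-refl Dx lone xe≉0 (λ w _ → ∈-vertices w)
      where
      -- The list `vs` covers the support of `x`, and the bound `k` on its length is what decreases:
      -- `remove` does not return a structural sublist.
      go : ∀ k (vs : List (C n)) {x} → length vs <ⁿ k → D x →
           (∀ w → w ∈ supp Y → w ≢ e → x w ≈ 0#) → ¬ (x e ≈ 0#) →
           ¬ (∀ w → ¬ (x w ≈ 0#) → w ∈ˡ vs)
      go (suc k) vs {x} (s≤s ∣vs∣≤k) Dx lone xe≉0 x⊆vs =
        case meet-twice (⊥Y _ minimal) (≉0⇒hasSign (signOf-hasSign (x e)) xe≉0) e∈Y of λ
          { (f , f≢e , f∈X , f∈Y) → hasSign⇒≉0 (signOf-hasSign (x f)) f∈X (lone f f∈Y f≢e) }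
        where
        smaller : ∀ {f} → ¬ (x f ≈ 0#) → length (remove f vs) <ⁿ k
        smaller xf≉0 = ℕ.<-≤-trans (length-remove (x⊆vs _ xf≉0)) ∣vs∣≤k

        shrink : ∀ {f y} → ¬ (x f ≈ 0#) → D y → y f ≈ 0# → (∀ w → x w ≈ 0# → y w ≈ 0#) →
                 ¬ ¬ (y e ≈ 0#)
        shrink {f} {y} xf≉0 Dy yf≈0 y⊆x ye≉0 =
          go k (remove f vs) (smaller xf≉0) Dy (λ w w∈Y w≢e → y⊆x w (lone w w∈Y w≢e)) ye≉0
            λ w yw≉0 → ∈-filter⁺ _ (x⊆vs w (yw≉0 ∘ y⊆x w)) λ { ≡.refl → yw≉0 yf≈0 }

        minimal : IsMinimalDependency ℝ D (signOf ∘ x)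
        minimal = record
          { coeff      = x
          ; dependency = Dx
          ; hasSigns   = signOf-hasSign ∘ x
          ; nonempty   = e , ≉0⇒hasSign (signOf-hasSign (x e)) xe≉0
          ; minimal    = λ { μ Dμ (f , μf≉0) μ⊆x g g∈X μg≈0 →
              let x≈0⇒μ≈0 : ∀ w → x w ≈ 0# → μ w ≈ 0#
                  x≈0⇒μ≈0 w xw≈0 = ≈0-stable λ μw≉0 →
                    hasSign⇒≉0 (signOf-hasSign (x w)) (μ⊆x w μw≉0) xw≈0
                  xf≉0 = μf≉0 ∘ x≈0⇒μ≈0 f
                  (r , μf*r≈1) = inverse (μ f) μf≉0
                  c = - 1# * (x f * r)
                  c*μf = begin
                    x f + - 1# * (x f * r) * μ f
                      ≈⟨ solve 4 (λ x m r y → x :+ m :* (x :* r) :* y := x :+ m :* (x :* (y :* r))) refl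
                           (x f) (- 1#) r (μ f) ⟩
                    x f + - 1# * (x f * (μ f * r))
                      ≈⟨ +-congˡ (*-congˡ (trans (*-congˡ μf*r≈1) (*-identityʳ (x f)))) ⟩
                    x f + - 1# * x f
                      ≈⟨ x+-1x≈0 (x f) ⟩
                    0# ∎
              -- If `μ` survives at `e`, it is a dependency through `e` that has lost `g`. If it
              -- vanishes at `e`, the multiple `c` of `μ` clears `x` at `f` and leaves the value at
              -- `e` alone. Either way the recursion applies to a shorter list.
              in shrink (hasSign⇒≉0 (signOf-hasSign (x g)) g∈X) Dμ μg≈0 x≈0⇒μ≈0 λ μe≈0 →
                 shrink xf≉0 (axpy c Dx Dμ) c*μf
                   (λ w xw≈0 → 0+c*0≈0 c xw≈0 (x≈0⇒μ≈0 w xw≈0))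
                   λ ye≈0 → xe≉0 (trans (sym (x+c*0≈x c μe≈0)) ye≈0) }
          }

  -- Parallelogram relations.

  -- The formal combination a - b - c + d, bracketed as the difference of the edges a - c and b - d
  -- so that `∑-axpy-*` evaluates it edge by edge.
  parallelogram : ∀ {n} → C n → C n → C n → C n → C n → Carrier
  parallelogram a b c d w = (δ a w + - 1# * δ c w) + - 1# * (δ b w + - 1# * δ d w)

  module _ {n} {a b c d w : C n} where
    parallelogram-off : a ≢ w → b ≢ w → c ≢ w → d ≢ w → parallelogram a b c d w ≈ 0#
    parallelogram-off a≢w b≢w c≢w d≢w =
      0+c*0≈0 _ (0+c*0≈0 _ (δ-≢ a≢w) (δ-≢ c≢w)) (0+c*0≈0 _ (δ-≢ b≢w) (δ-≢ d≢w))

    parallelogram-a : a ≡ w → b ≢ w → c ≢ w → d ≢ w → parallelogram a b c d w ≈ 1#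
    parallelogram-a a≡w b≢w c≢w d≢w =
      trans (x+c*0≈x _ (0+c*0≈0 _ (δ-≢ b≢w) (δ-≢ d≢w))) (trans (x+c*0≈x _ (δ-≢ c≢w)) (δ-≡ a≡w))

    parallelogram-b : a ≢ w → b ≡ w → c ≢ w → d ≢ w → parallelogram a b c d w ≈ - 1#
    parallelogram-b a≢w b≡w c≢w d≢w =
      trans (+-cong (0+c*0≈0 _ (δ-≢ a≢w) (δ-≢ c≢w)) (*-congˡ (trans (x+c*0≈x _ (δ-≢ d≢w)) (δ-≡ b≡w))))
            (trans (+-identityˡ _) (*-identityʳ _))

    parallelogram-c : a ≢ w → b ≢ w → c ≡ w → d ≢ w → parallelogram a b c d w ≈ - 1#
    parallelogram-c a≢w b≢w c≡w d≢w =
      trans (x+c*0≈x _ (0+c*0≈0 _ (δ-≢ b≢w) (δ-≢ d≢w)))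
            (trans (+-cong (δ-≢ a≢w) (*-congˡ (δ-≡ c≡w))) (trans (+-identityˡ _) (*-identityʳ _)))

    parallelogram-d : a ≢ w → b ≢ w → c ≢ w → d ≡ w → parallelogram a b c d w ≈ 1#
    parallelogram-d a≢w b≢w c≢w d≡w =
      trans (+-cong (0+c*0≈0 _ (δ-≢ a≢w) (δ-≢ c≢w)) (*-congˡ (+-cong (δ-≢ b≢w) (*-congˡ (δ-≡ d≡w)))))
            (trans (+-identityˡ _) (trans (*-congˡ (trans (+-identityˡ _) (*-identityʳ _)))
              (trans (-1*x≈-x _) (-‿involutive 1#))))

  -- Coordinates can be checked one at a time: in each, one pair of opposite sides is constant, and
  -- then the four signed values cancel.
  parallelogram-dependency : ∀ {n} (a b c d : C n) →
    (∀ k → (lookup a k ≡ lookup c k × lookup b k ≡ lookup d k) ⊎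
           (lookup a k ≡ lookup b k × lookup c k ≡ lookup d k)) →
    AffineDependency ℝ (point ℝ) (parallelogram a b c d)
  parallelogram-dependency {n} a b c d sides =
    trans (∑-cong n (λ v → sym (*-identityʳ _)))
      (trans (∑-parallelogram (λ _ → 1#)) (0+c*0≈0 _ (x+-1x≈0 1#) (x+-1x≈0 1#))) ,
    λ k → trans (∑-parallelogram _) (cancel (sides k))
    where
    ∑-parallelogram : ∀ (h : C n → Carrier) → ∑ ℝ n (λ v → parallelogram a b c d v * h v) ≈
                      (h a + - 1# * h c) + - 1# * (h b + - 1# * h d)
    ∑-parallelogram h = trans (∑-axpy-* n _ (- 1#) _ h)
      (+-cong (edge a c) (*-congˡ (edge b d)))
      where
      edge : ∀ a c → ∑ ℝ n (λ v → (δ a v + - 1# * δ c v) * h v) ≈ h a + - 1# * h c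
      edge a c = trans (∑-axpy-* n (δ a) (- 1#) (δ c) h) (+-cong (∑-δ n a h) (*-congˡ (∑-δ n c h)))

    cancel : ∀ {p q r s} → (p ≡ r × q ≡ s) ⊎ (p ≡ q × r ≡ s) →
             (signValue ℝ p + - 1# * signValue ℝ r) + - 1# * (signValue ℝ q + - 1# * signValue ℝ s) ≈ 0#
    cancel (inj₁ (≡.refl , ≡.refl)) = 0+c*0≈0 _ (x+-1x≈0 _) (x+-1x≈0 _)
    cancel (inj₂ (≡.refl , ≡.refl)) = x+-1x≈0 _

  -- Facet cocircuits.

  -- The sign of `1 + s * t`, which is 2 for equal signs and 0 for opposite ones.
  halfSign : Sign → Sign → Maybe Sign
  halfSign s t = if does (s Sign.≟ t) then just Sign.+ else nothing

  halfSign-hasSign : ∀ s t → HasSign ℝ (halfSign s t) (1# + signValue ℝ s * signValue ℝ t)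
  halfSign-hasSign Sign.+ Sign.+ = pos-+ 0<1 (*-pos 0<1 0<1)
  halfSign-hasSign Sign.+ Sign.- = trans (+-congˡ (*-identityˡ _)) (-‿inverseʳ 1#)
  halfSign-hasSign Sign.- Sign.+ = trans (+-congˡ (*-identityʳ _)) (-‿inverseʳ 1#)
  halfSign-hasSign Sign.- Sign.- = pos-+ 0<1 (neg*neg (-‿pos 0<1) (-‿pos 0<1))

  -- The sign vector of the affine functional `1 + s * v i`, which is nonnegative on the cube and
  -- vanishes on the facet opposite to `s`.
  facetCovector : ∀ {n} → Fin n → Sign → SignedSet (C n)
  facetCovector i s v = halfSign s (lookup v i)

  module _ {n} (i : Fin n) (s : Sign) (v : C n) where
    ∈-facetCovector⁻ : v ∈ supp (facetCovector i s) → lookup v i ≡ s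
    ∈-facetCovector⁻ v∈Y with s Sign.≟ lookup v i
    ... | yes s≡t = ≡.sym s≡t
    ... | no  _   = contradiction ≡.refl v∈Y

    ∈-facetCovector⁺ : lookup v i ≡ s → v ∈ supp (facetCovector i s)
    ∈-facetCovector⁺ t≡s with s Sign.≟ lookup v i
    ... | yes _   = λ ()
    ... | no  s≢t = contradiction (≡.sym t≡s) s≢t

  supp-facetCovector : ∀ {n} (i : Fin n) s → supp (facetCovector i s) ≐ ∁ (facet i (Sign.opposite s))
  supp-facetCovector i s =
    (λ {v} v∈Y t≡-s → Sign.s≢opposite[s] s (≡.trans (≡.sym (∈-facetCovector⁻ i s v v∈Y)) t≡-s)) ,
    λ {v} t≢-s → ∈-facetCovector⁺ i s v (two-signs s _ t≢-s)
    where
    two-signs : ∀ s t → t ≢ Sign.opposite s → t ≡ s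
    two-signs Sign.+ Sign.+ _ = ≡.refl
    two-signs Sign.+ Sign.- q = contradiction ≡.refl q
    two-signs Sign.- Sign.+ q = contradiction ≡.refl q
    two-signs Sign.- Sign.- _ = ≡.refl

  -- Orthogonality holds because an affine dependency annihilates every affine functional, here
  -- `1 + s * v i`. Minimality uses that any two vertices of the facet form a side of a
  -- parallelogram whose other side lies in the opposite facet.
  facetCovector-isCocircuit : ∀ {n} (i : Fin n) s → IsCocircuit (Q ℝ n) (facetCovector i s)
  facetCovector-isCocircuit {n} i s = record
    { orthogonal = λ X X-circuit → let open IsMinimalDependency X-circuit in
        ∑≈0⇒⊥ coeff _ hasSigns (λ v → halfSign-hasSign s (lookup v i)) (balanced dependency)
    ; nonempty   = replicate n s , ∈-facetCovector⁺ i s (replicate n s) (lookup-replicate i s)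
    ; minimal    = λ { Z ⊥Z (e , e∈Z) Z⊆Y {f} → minimal Z ⊥Z e e∈Z Z⊆Y f }
    }
    where
    opp : C n → C n
    opp v = updateAt v i Sign.opposite

    leaves : ∀ v w → lookup v i ≡ s → lookup w i ≡ s → opp v ≢ w
    leaves v w vi≡s wi≡s ≡.refl = Sign.s≢opposite[s] s
      (≡.trans (≡.sym wi≡s) (≡.trans (lookup∘updateAt i v) (≡.cong Sign.opposite vi≡s)))

    parallel : ∀ e f → lookup e i ≡ s → lookup f i ≡ s → ∀ k →
      (lookup e k ≡ lookup (opp e) k × lookup f k ≡ lookup (opp f) k) ⊎
      (lookup e k ≡ lookup f k × lookup (opp e) k ≡ lookup (opp f) k)
    parallel e f ei≡s fi≡s k with k Fin.≟ i
    ... | no k≢i = inj₁ (≡.sym (lookup∘updateAt′ k i k≢i e) , ≡.sym (lookup∘updateAt′ k i k≢i f))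
    ... | yes ≡.refl = inj₂ (ei≡fi , ≡.trans (lookup∘updateAt i e)
      (≡.trans (≡.cong Sign.opposite ei≡fi) (≡.sym (lookup∘updateAt i f))))
      where
      ei≡fi = ≡.trans ei≡s (≡.sym fi≡s)

    balanced : ∀ {x} → AffineDependency ℝ (point ℝ) x →
               ∑ ℝ n (λ v → x v * (1# + signValue ℝ s * point ℝ v i)) ≈ 0#
    balanced {x} (∑x , lin) = trans
      (∑-cong n (λ v → solve 3 (λ x s p → x :* (con 1 :+ s :* p) := x :+ s :* (x :* p)) refl
        (x v) (signValue ℝ s) (point ℝ v i)))
      (trans (∑-axpy n x _ _) (0+c*0≈0 _ ∑x (lin i)))

    -- Z avoiding f would meet the parallelogram e, f, opp e, opp f in e alone.
    minimal : ∀ Z → (∀ X → Q ℝ n X → X ⊥ Z) → ∀ e → e ∈ supp Z → supp Z ⊆ supp (facetCovector i s) →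
              ∀ f → f ∈ supp (facetCovector i s) → f ∈ supp Z
    minimal Z ⊥Z e e∈Z Z⊆Y f f∈Y Zf≡nothing = pos⇒≉0 0<1 (trans
      (sym (parallelogram-a {c = opp e} {opp f} ≡.refl (f≢ e e∈Z)
        (leaves e e ei≡s ei≡s) (leaves f e fi≡s ei≡s)))
      (vanishes-at-lone (affineDependency-isSubspace (point ℝ)) ⊥Z e∈Z
        (parallelogram-dependency e f (opp e) (opp f) (parallel e f ei≡s fi≡s))
        λ w w∈Z w≢e → parallelogram-off {a = e} {f} {opp e} {opp f} (w≢e ∘ ≡.sym) (f≢ w w∈Z)
          (leaves e w ei≡s (on w w∈Z)) (leaves f w fi≡s (on w w∈Z))))
      where
      on : ∀ w → w ∈ supp Z → lookup w i ≡ s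
      on w w∈Z = ∈-facetCovector⁻ i s w (Z⊆Y w∈Z)
      ei≡s = on e e∈Z
      fi≡s = ∈-facetCovector⁻ i s f f∈Y
      f≢ : ∀ w → w ∈ supp Z → f ≢ w
      f≢ w w∈Z ≡.refl = w∈Z Zf≡nothing

  -- The form in which the facet cocircuits are used from here on. As a property of the space alone
  -- it applies to both spaces being compared and survives positive rescaling.
  FacetProperty : ∀ {n} → Pred (C n → Carrier) 0ℓ → Set
  FacetProperty D = ∀ i s e {x} → D x → lookup e i ≡ s →
    (∀ w → lookup w i ≡ s → w ≢ e → x w ≈ 0#) → x e ≈ 0#

  facetProperty : ∀ {n} {D : Pred (C n → Carrier) 0ℓ} → IsSubspace D →
    (∀ i s X → IsMinimalDependency ℝ D X → X ⊥ facetCovector i s) → FacetProperty D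
  facetProperty D-sub ⊥Y i s e Dx ei≡s off = vanishes-at-lone D-sub (⊥Y i s)
    (∈-facetCovector⁺ i s e ei≡s) Dx (λ w w∈Y → off w (∈-facetCovector⁻ i s w w∈Y))

  -- Weights of the vertices relative to the all-minus vertex.

  record RectangleDependency {n} (D : Pred (C n → Carrier) 0ℓ) (A B : Subset n) : Set where
    field
      coeff      : C n → Carrier
      dependency : D coeff
      coeff-AB   : 0# < coeff (at (A Subset.∪ B))
      coeff-A    : coeff (at A) < 0#
      coeff-B    : coeff (at B) < 0#
      coeff-𝟎    : 0# < coeff 𝟎
      coeff-off  : ∀ w → at (A Subset.∪ B) ≢ w → at A ≢ w → at B ≢ w → 𝟎 ≢ w → coeff w ≈ 0#

  rectangleDependency : ∀ {n} {D : Pred (C n → Carrier) 0ℓ} {A B : Subset n} → Splits A B →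
    IsMinimalDependency ℝ D (rectangle A B) → RectangleDependency D A B
  rectangleDependency {A = A} {B} sp circuit = record
    { coeff      = coeff
    ; dependency = dependency
    ; coeff-AB   = signed (rectangle-AB sp)
    ; coeff-A    = signed (rectangle-A sp)
    ; coeff-B    = signed (rectangle-B sp)
    ; coeff-𝟎    = signed (rectangle-𝟎 sp)
    ; coeff-off  = λ w p q r s → signed (rectangle-other sp w p q r s)
    }
    where
    open IsMinimalDependency circuit
    signed : ∀ {w σ} → rectangle A B w ≡ σ → HasSign ℝ σ (coeff w)
    signed {w} ≡.refl = hasSigns w

  module _ {n} {D : Pred (C n → Carrier) 0ℓ} (D-sub : IsSubspace D) (D-facet : FacetProperty D)
           (D-rect : ∀ A B → Splits A B → RectangleDependency D A B) where
    open IsSubspace D-sub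

    𝟏 : C n
    𝟏 = at ⊤

    -- Modulo `D` and the vertices off the facet w(i) = -1, the vertex `v` equals `t` times `𝟏`. The
    -- same `t` serves every such facet through `v`; at `𝟎` there is none, and only positivity
    -- remains.
    Weight : C n → Set
    Weight v = Σ[ t ∈ Carrier ] 0# < t × (∀ i → lookup v i ≡ Sign.- →
      Σ[ ν ∈ (C n → Carrier) ] D ν × (∀ w → lookup w i ≡ Sign.- →
        ν w ≈ t * δ 𝟏 w + - 1# * δ v w))

    weight-at : ∀ S → Weight (at S)
    weight-at S with Subset.nonempty? S | Subset.nonempty? (Subset.∁ S)
    -- For the vertex `𝟎` the value 1 is an arbitrary default.
    ... | no S≡∅ | _ = 1# , 0<1 , λ i p → contradiction (i , lookup-at⁻ p) S≡∅
    ... | yes _ | no ∁S≡∅ = 1# , 0<1 , λ i p → _ , origin , λ w _ → sym (trans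
      (+-cong (*-identityˡ _) (*-congˡ (reflexive (≡.cong (λ A → δ (at A) w) S≡⊤))))
      (x+-1x≈0 _))
      where
      S≡⊤ : S ≡ ⊤
      S≡⊤ = ≡.trans (≡.sym (Subset.∪-identityʳ S))
        (≡.trans (≡.cong (S Subset.∪_) (≡.sym (Subset.Empty-unique ∁S≡∅))) (Subset.p∪∁p≡⊤ S))
    -- The rectangle on `𝟎`, `S`, its complement and `𝟏`, scaled by `y` to have coefficient `- 1#`
    -- at `S`. Its corners `𝟎` and the complement lie off every facet w(i) = -1 with i in `S`.
    ... | yes S≢∅ | yes ∁S≢∅ = y * coeff (at (S Subset.∪ Subset.∁ S)) , *-pos 0<y coeff-AB ,
      λ i p → _ , scale y dependency , λ w q →
        trans (value i w q (lookup-at⁻ p) (corner? S (Subset.∁ S) w))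
          (+-congʳ (*-congˡ (reflexive (≡.cong (λ A → δ (at A) w) (Subset.p∪∁p≡⊤ S)))))
      where
      sp = Splits-∁ S≢∅ ∁S≢∅
      open Splits sp
      open RectangleDependency (D-rect S (Subset.∁ S) sp)
      inv = reciprocal (-‿neg coeff-A)
      y = proj₁ inv
      0<y = proj₁ (proj₂ inv)
      value : ∀ i w → lookup w i ≡ Sign.- → i ∈ˢ S → Corner S (Subset.∁ S) w →
              y * coeff w ≈ (y * coeff (at (S Subset.∪ Subset.∁ S))) * δ (at (S Subset.∪ Subset.∁ S)) w
                            + - 1# * δ (at S) w
      value i w q i∈S (is-AB ≡.refl) = sym (trans (x+c*0≈x _ (δ-≢ (AB≢A ∘ ≡.sym)))
        (trans (*-congˡ (δ-≡ {a = at (S Subset.∪ Subset.∁ S)} ≡.refl)) (*-identityʳ _)))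
      value i w q i∈S (is-A ≡.refl) = begin
        y * coeff (at S)         ≈⟨ *-comm _ _ ⟩
        coeff (at S) * y         ≈⟨ *-congʳ (-‿involutive _) ⟨
        - (- coeff (at S)) * y   ≈⟨ -‿distribˡ-* _ _ ⟨
        - (- coeff (at S) * y)   ≈⟨ -‿cong (proj₂ (proj₂ inv)) ⟩
        - 1#                     ≈⟨ *-identityʳ _ ⟨
        - 1# * 1#                ≈⟨ +-identityˡ _ ⟨
        0# + - 1# * 1#           ≈⟨ +-cong (trans (*-congˡ (δ-≢ AB≢A)) (zeroʳ _)) (*-congˡ (δ-≡ {a = at S} ≡.refl)) ⟨
        _ ∎
      value i w q i∈S (is-B p) = contradiction (≡.sym p) (separated i q (lookup-at-∉ (B∌ i∈S)))
      value i w q i∈S (is-𝟎 p) = contradiction (≡.sym p) (separated i q (lookup-𝟎 i))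
      value i w q i∈S (other p₁ p₂ p₃ p₄) = trans (trans (*-congˡ (coeff-off w p₁ p₂ p₃ p₄)) (zeroʳ y))
        (sym (0+c*0≈0 _ (trans (*-congˡ (δ-≢ p₁)) (zeroʳ _)) (δ-≢ p₂)))

    weight : ∀ v → Weight v
    weight v = ≡.subst Weight (at-minuses v) (weight-at (minuses v))

    wt : C n → Carrier
    wt v = proj₁ (weight v)

    0<wt : ∀ v → 0# < wt v
    0<wt v = proj₁ (proj₂ (weight v))

    -- Adding `x a` times the relation for `a` and `x b` times the one for `b` moves both values to
    -- `𝟏`. On the facet of `i` the result `z` is then supported at `𝟏` alone, with the weighted sum
    -- as its value, and `D-facet` makes that value zero.
    balance : ∀ i a b {x} → D x → lookup a i ≡ Sign.- → lookup b i ≡ Sign.- → a ≢ b →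
              (∀ w → lookup w i ≡ Sign.- → a ≢ w → b ≢ w → x w ≈ 0#) →
              wt a * x a + wt b * x b ≈ 0#
    balance i a b {x} Dx ai bi a≢b off = begin
      k                     ≈⟨ *-identityˡ k ⟨
      1# * k                ≈⟨ *-congʳ (δ-≡ {a = 𝟏} ≡.refl) ⟨
      δ 𝟏 𝟏 * k   ≈⟨ z≈ 𝟏 ⊤i ⟨
      z 𝟏              ≈⟨ D-facet i Sign.- 𝟏 Dz ⊤i (λ w wi w≢⊤ →
                                 trans (z≈ w wi) (trans (*-congʳ (δ-≢ (w≢⊤ ∘ ≡.sym))) (zeroˡ k))) ⟩
      0#                    ∎
      where
      ν = proj₂ (proj₂ (weight a)) i ai
      μ = proj₂ (proj₂ (weight b)) i bi
      k = wt a * x a + wt b * x b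
      z : C n → Carrier
      z v = (x v + x a * proj₁ ν v) + x b * proj₁ μ v
      Dz : D z
      Dz = axpy (x b) (axpy (x a) Dx (proj₁ (proj₂ ν))) (proj₁ (proj₂ μ))
      ⊤i : lookup 𝟏 i ≡ Sign.-
      ⊤i = lookup-at-∈ {A = ⊤ {n}} Subset.∈⊤
      spread : ∀ w → lookup w i ≡ Sign.- → x w ≈ x a * δ a w + x b * δ b w
      spread w wi with a ≟ᵛ w | b ≟ᵛ w
      ... | yes p      | yes q      = contradiction (≡.trans p (≡.sym q)) a≢b
      ... | yes ≡.refl | no  _      = sym (trans (x+c*0≈x _ refl) (*-identityʳ _))
      ... | no _       | yes ≡.refl = sym (trans (+-congʳ (zeroʳ _)) (trans (+-identityˡ _) (*-identityʳ _)))
      ... | no p       | no q       = trans (off w wi p q) (sym (0+c*0≈0 _ (zeroʳ _) refl))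
      z≈ : ∀ w → lookup w i ≡ Sign.- → z w ≈ δ 𝟏 w * k
      z≈ w wi = begin
        (x w + x a * proj₁ ν w) + x b * proj₁ μ w
          ≈⟨ +-cong (+-cong (spread w wi) (*-congˡ (proj₂ (proj₂ ν) w wi))) (*-congˡ (proj₂ (proj₂ μ) w wi)) ⟩
        ((x a * δ a w + x b * δ b w) + x a * (wt a * δ 𝟏 w + - 1# * δ a w))
          + x b * (wt b * δ 𝟏 w + - 1# * δ b w)
          ≈⟨ solve 8 (λ xa xb da db d ta tb m →
               ((xa :* da :+ xb :* db) :+ xa :* (ta :* d :+ m :* da)) :+ xb :* (tb :* d :+ m :* db) :=
               (d :* (ta :* xa :+ tb :* xb)) :+ (con 1 :+ m) :* (xa :* da :+ xb :* db)) refl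
               (x a) (x b) (δ a w) (δ b w) (δ 𝟏 w) (wt a) (wt b) (- 1#) ⟩
        δ 𝟏 w * k + (1# + - 1#) * (x a * δ a w + x b * δ b w)
          ≈⟨ +-congˡ (trans (*-congʳ (-‿inverseʳ 1#)) (zeroˡ _)) ⟩
        δ 𝟏 w * k + 0#
          ≈⟨ +-identityʳ _ ⟩
        δ 𝟏 w * k ∎

    -- Normalised rectangle dependencies and their value at `𝟎`.

    -- The weights normalise three corners. The fourth, `𝟎`, lies on no facet w(i) = -1, so its
    -- coefficient `apex` is so far known only to be positive.
    record Triangle (A B : Subset n) : Set where
      field
        coeff      : C n → Carrier
        dependency : D coeff
        coeff-AB   : wt (at (A Subset.∪ B)) * coeff (at (A Subset.∪ B)) ≈ 1#
        coeff-A    : wt (at A) * coeff (at A) ≈ - 1#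
        coeff-B    : wt (at B) * coeff (at B) ≈ - 1#
        0<apex     : 0# < coeff 𝟎
        coeff-off  : ∀ w → at (A Subset.∪ B) ≢ w → at A ≢ w → at B ≢ w → 𝟎 ≢ w → coeff w ≈ 0#

      apex : Carrier
      apex = coeff 𝟎

    -- For i in `A`, the facet w(i) = -1 contains just the corners `A ∪ B` and `A` of the rectangle,
    -- so `balance` makes their weighted coefficients opposite; i in `B` does the same for `B`. The
    -- factor `y` turns the weighted coefficient at `A ∪ B` into 1.
    triangle : ∀ {A B} → Splits A B → Triangle A B
    triangle {A} {B} sp = record
      { coeff      = λ v → y * R.coeff v
      ; dependency = scale y R.dependency
      ; coeff-AB   = trans (solve 3 (λ t y x → t :* (y :* x) := (t :* x) :* y) refl (wt AB) y (R.coeff AB)) κy≈1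
      ; coeff-A    = side (let i , i∈A = A≢∅ in balance i AB (at A) R.dependency
          (lookup-at-∈ (AB⊇A i∈A)) (lookup-at-∈ i∈A) AB≢A
          (λ w wi p q → R.coeff-off w p q
            (separated i wi (lookup-at-∉ (B∌ i∈A)) ∘ ≡.sym)
            (separated i wi (lookup-𝟎 i) ∘ ≡.sym)))
      ; coeff-B    = side (let i , i∈B = B≢∅ in balance i AB (at B) R.dependency
          (lookup-at-∈ (AB⊇B i∈B)) (lookup-at-∈ i∈B) AB≢B
          (λ w wi p q → R.coeff-off w p
            (separated i wi (lookup-at-∉ (A∌ i∈B)) ∘ ≡.sym) q
            (separated i wi (lookup-𝟎 i) ∘ ≡.sym)))
      ; 0<apex     = *-pos 0<y R.coeff-𝟎
      ; coeff-off  = λ w p q r s → trans (*-congˡ (R.coeff-off w p q r s)) (zeroʳ y)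
      }
      where
      open Splits sp
      module R = RectangleDependency (D-rect A B sp)
      AB = at (A Subset.∪ B)
      inv = reciprocal (*-pos (0<wt AB) R.coeff-AB)
      y = proj₁ inv
      0<y = proj₁ (proj₂ inv)
      κy≈1 = proj₂ (proj₂ inv)
      side : ∀ {v} → wt AB * R.coeff AB + wt v * R.coeff v ≈ 0# → wt v * (y * R.coeff v) ≈ - 1#
      side {v} eq = +-inverseˡ-unique _ 1# (begin
        wt v * (y * R.coeff v) + 1#
          ≈⟨ +-congˡ κy≈1 ⟨
        wt v * (y * R.coeff v) + (wt AB * R.coeff AB) * y
          ≈⟨ solve 4 (λ t x y κ → t :* (y :* x) :+ κ :* y := y :* (κ :+ t :* x)) refl
               (wt v) (R.coeff v) y (wt AB * R.coeff AB) ⟩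
        y * (wt AB * R.coeff AB + wt v * R.coeff v)
          ≈⟨ trans (*-congˡ eq) (zeroʳ y) ⟩
        0# ∎)

    Triangle-sym : ∀ {A B} (τ : Triangle A B) → Σ[ σ ∈ Triangle B A ] Triangle.apex σ ≈ Triangle.apex τ
    Triangle-sym {A} {B} τ = record
      { coeff = coeff ; dependency = dependency
      ; coeff-AB = ≡.subst (λ S → wt (at S) * coeff (at S) ≈ 1#) (Subset.∪-comm A B) coeff-AB
      ; coeff-A = coeff-B ; coeff-B = coeff-A ; 0<apex = 0<apex
      ; coeff-off = λ w p q r s →
          coeff-off w (p ∘ ≡.trans (≡.cong at (Subset.∪-comm B A))) r q s
      } , refl
      where open Triangle τ

    -- The difference of the two triangles is supported at 𝟎 on the facet w(i) = 1.
    apex-unique : ∀ {A A′ B i} (τ : Triangle A B) (τ′ : Triangle A′ B) → i ∈ˢ A → i ∈ˢ A′ →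
                  Triangle.apex τ ≈ Triangle.apex τ′
    apex-unique {A} {A′} {B} {i} τ τ′ i∈A i∈A′ = x+-1y≈0⇒x≈y
      (D-facet i Sign.+ 𝟎 (axpy (- 1#) T.dependency T′.dependency) (lookup-𝟎 i) off)
      where
      module T  = Triangle τ
      module T′ = Triangle τ′
      off : ∀ w → lookup w i ≡ Sign.+ → w ≢ 𝟎 → T.coeff w + - 1# * T′.coeff w ≈ 0#
      off w wi w≢𝟎 with at B ≟ᵛ w
      ... | yes ≡.refl = trans (+-congʳ (*-cancelˡ (pos⇒≉0 (0<wt (at B)))
              (trans T.coeff-B (sym T′.coeff-B)))) (x+-1x≈0 _)
      ... | no B≢w = 0+c*0≈0 _
              (T.coeff-off w (separated i (lookup-at-∈ (Subset.x∈p∪q⁺ (inj₁ i∈A))) wi)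
                (separated i (lookup-at-∈ i∈A) wi) B≢w (w≢𝟎 ∘ ≡.sym))
              (T′.coeff-off w (separated i (lookup-at-∈ (Subset.x∈p∪q⁺ (inj₁ i∈A′))) wi)
                (separated i (lookup-at-∈ i∈A′) wi) B≢w (w≢𝟎 ∘ ≡.sym))

    -- With the second set held fixed, `apex-unique` exchanges the first for another one sharing an
    -- element. Together with swapping, this leads from (A, B) through ({i}, B), (B, {i}) and (∁{i},
    -- {i}) to ({i}, ∁{i}).
    apex-⁅⁆ : ∀ {A B i} → Splits A B → (τ : Triangle A B) → i ∈ˢ A → (σ : Triangle ⁅ i ⁆ (Subset.∁ ⁅ i ⁆)) →
              Triangle.apex τ ≈ Triangle.apex σ
    apex-⁅⁆ {i = i} sp τ i∈A σ = let
        ρ          = triangle (Splits-⁅⁆ (B∌ i∈A) B≢∅)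
        ρ′ , ρ′≈ρ  = Triangle-sym ρ
        σ′ , σ′≈σ  = Triangle-sym σ
        j , j∈B    = B≢∅
      in trans (apex-unique τ ρ i∈A (Subset.x∈⁅x⁆ i))
           (trans (sym ρ′≈ρ) (trans (apex-unique ρ′ σ′ j∈B (∈-∁⁅⁆ sp i∈A j∈B)) σ′≈σ))
      where open Splits sp

    -- Both apexes reduce to singletons by `apex-⁅⁆`. Swapping ({i}, ∁{i}) puts `j` into the first
    -- set, so the same lemma leads on to ({j}, ∁{j}).
    apex-≢ : ∀ {A B A′ B′ i j} → Splits A B → Splits A′ B′ → (τ : Triangle A B) (τ′ : Triangle A′ B′) →
             i ∈ˢ A → j ∈ˢ A′ → i ≢ j → Triangle.apex τ ≈ Triangle.apex τ′
    apex-≢ {i = i} {j} sp sp′ τ τ′ i∈A j∈A′ i≢j = let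
        σᵢ          = triangle (split i≢j)
        σⱼ          = triangle (split (i≢j ∘ ≡.sym))
        σᵢ′ , σᵢ′≈σᵢ = Triangle-sym σᵢ
      in trans (apex-⁅⁆ sp τ i∈A σᵢ) (trans (sym σᵢ′≈σᵢ)
           (trans (apex-⁅⁆ (Splits-sym (split i≢j)) σᵢ′ (∈-∁ i≢j) σⱼ) (sym (apex-⁅⁆ sp′ τ′ j∈A′ σⱼ))))
      where
      ∈-∁ : ∀ {i j : Fin n} → i ≢ j → j ∈ˢ Subset.∁ ⁅ i ⁆
      ∈-∁ i≢j = Subset.x∉p⇒x∈∁p (Subset.x≢y⇒x∉⁅y⁆ (i≢j ∘ ≡.sym))
      split : ∀ {i j : Fin n} → i ≢ j → Splits ⁅ i ⁆ (Subset.∁ ⁅ i ⁆)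
      split {i} i≢j = Splits-∁ (i , Subset.x∈⁅x⁆ i) (_ , ∈-∁ i≢j)

    apex-constant : ∀ {A B A′ B′} → Splits A B → Splits A′ B′ → (τ : Triangle A B) (τ′ : Triangle A′ B′) →
                    Triangle.apex τ ≈ Triangle.apex τ′
    apex-constant sp sp′ τ τ′ with S.A≢∅ | S′.A≢∅ | S′.B≢∅
      where
      module S  = Splits sp
      module S′ = Splits sp′
    ... | i , i∈A | j , j∈A′ | k , k∈B′ with i Fin.≟ j
    ...   | no i≢j     = apex-≢ sp sp′ τ τ′ i∈A j∈A′ i≢j
    -- When the chosen elements of `A` and `A′` coincide, swapping `τ′` offers an element of `B′`
    -- instead, which differs because `A′` and `B′` are disjoint.
    ...   | yes ≡.refl = let τ″ , τ″≈τ′ = Triangle-sym τ′ in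
      trans (apex-≢ sp (Splits-sym sp′) τ τ″ i∈A k∈B′
              (λ { ≡.refl → Splits.B∌ sp′ j∈A′ k∈B′ })) τ″≈τ′

    apex-scale : Σ[ c ∈ Carrier ] 0# < c × (∀ {A B} → Splits A B → (τ : Triangle A B) →
                 c * Triangle.apex τ ≈ 1#)
    apex-scale with Fin.any? (λ i → Subset.nonempty? (Subset.∁ ⁅ i ⁆))
    ... | yes (i , ∁i≢∅) = let
          sp₀            = Splits-∁ (i , Subset.x∈⁅x⁆ i) ∁i≢∅
          τ₀             = triangle sp₀
          c , 0<c , ρc≈1 = reciprocal (Triangle.0<apex τ₀)
        in c , 0<c , λ sp τ →
             trans (*-congˡ (apex-constant sp sp₀ τ τ₀)) (trans (*-comm _ _) ρc≈1)
    -- No singleton has a nonempty complement, so no splitting pair exists and any positive constant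
    -- would do.
    ... | no all-empty = 1# , 0<1 , λ sp τ → let open Splits sp ; (i , i∈A) = A≢∅ ; (j , j∈B) = B≢∅ in
          contradiction (i , j , ∈-∁⁅⁆ sp i∈A j∈B) all-empty

    normalised-parallelograms :
      Σ[ t ∈ (C n → Carrier) ] (∀ v → 0# < t v) × (∀ A B → Splits A B →
        Σ[ x ∈ (C n → Carrier) ] D x ×
          (∀ w → t w * x w ≈ parallelogram (at (A Subset.∪ B)) (at A) (at B) 𝟎 w))
    normalised-parallelograms = t , 0<t , λ A B sp → let τ = triangle sp in
        Triangle.coeff τ , Triangle.dependency τ , λ w → value sp τ (corner? A B w)
      where
      c = proj₁ apex-scale
      t : C n → Carrier
      -- The weight of `𝟎` carried no information; it is replaced by the common reciprocal `c` of
      -- all the apexes.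
      t w = if does (𝟎 ≟ᵛ w) then c else wt w
      0<t : ∀ w → 0# < t w
      0<t w with 𝟎 ≟ᵛ w
      ... | yes _ = proj₁ (proj₂ apex-scale)
      ... | no  _ = 0<wt w
      t-𝟎 : ∀ {w} → 𝟎 ≡ w → t w ≈ c
      t-𝟎 {w} p with 𝟎 ≟ᵛ w
      ... | yes _ = refl
      ... | no  q = contradiction p q
      t-≢ : ∀ {w} → w ≢ 𝟎 → t w ≈ wt w
      t-≢ {w} p with 𝟎 ≟ᵛ w
      ... | yes q = contradiction (≡.sym q) p
      ... | no  _ = refl
      value : ∀ {A B w} → Splits A B → (τ : Triangle A B) → Corner A B w →
              t w * Triangle.coeff τ w ≈ parallelogram (at (A Subset.∪ B)) (at A) (at B) 𝟎 w
      value {A} {B} sp τ corner = go corner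
        where
        open Splits sp
        open Triangle τ
        AB = at (A Subset.∪ B)
        go : ∀ {w} → Corner A B w → t w * coeff w ≈ parallelogram AB (at A) (at B) 𝟎 w
        go (is-AB ≡.refl) = trans (trans (*-congʳ (t-≢ AB≢𝟎)) coeff-AB)
          (sym (parallelogram-a {a = AB} {at A} {at B} {𝟎} ≡.refl (AB≢A ∘ ≡.sym) (AB≢B ∘ ≡.sym) (AB≢𝟎 ∘ ≡.sym)))
        go (is-A ≡.refl) = trans (trans (*-congʳ (t-≢ A≢𝟎)) coeff-A)
          (sym (parallelogram-b {a = AB} {at A} {at B} {𝟎} AB≢A ≡.refl (A≢B ∘ ≡.sym) (A≢𝟎 ∘ ≡.sym)))
        go (is-B ≡.refl) = trans (trans (*-congʳ (t-≢ B≢𝟎)) coeff-B)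
          (sym (parallelogram-c {a = AB} {at A} {at B} {𝟎} AB≢B A≢B ≡.refl (B≢𝟎 ∘ ≡.sym)))
        go (is-𝟎 ≡.refl) = trans (trans (*-congʳ (t-𝟎 ≡.refl)) (proj₂ (proj₂ apex-scale) sp τ))
          (sym (parallelogram-d {a = AB} {at A} {at B} {𝟎} AB≢𝟎 A≢𝟎 B≢𝟎 ≡.refl))
        go {w} (other p q r s) = trans (trans (*-congˡ (coeff-off w p q r s)) (zeroʳ _))
          (sym (parallelogram-off {a = AB} {at A} {at B} {𝟎} p q r s))

  -- Comparing two spaces that contain the parallelograms.

  Splits⇒affineDependency : ∀ {n} {A B : Subset n} → Splits A B →
    AffineDependency ℝ (point ℝ) (parallelogram (at (A Subset.∪ B)) (at A) (at B) 𝟎)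
  Splits⇒affineDependency {A = A} {B} sp =
    parallelogram-dependency (at (A Subset.∪ B)) (at A) (at B) 𝟎 sides
    where
    open Splits sp
    sides : ∀ k → _
    sides k with k Subset.∈? A | k Subset.∈? B
    ... | yes k∈A | _ = inj₂
      ( ≡.trans (lookup-at-∈ (AB⊇A k∈A)) (≡.sym (lookup-at-∈ k∈A))
      , ≡.trans (lookup-at-∉ (B∌ k∈A)) (≡.sym (lookup-𝟎 k)))
    ... | no k∉A | yes k∈B = inj₁
      ( ≡.trans (lookup-at-∈ (AB⊇B k∈B)) (≡.sym (lookup-at-∈ k∈B))
      , ≡.trans (lookup-at-∉ k∉A) (≡.sym (lookup-𝟎 k)))
    ... | no k∉A | no k∉B = inj₁
      ( ≡.trans (lookup-at-∉ (λ k∈AB → Sum.[ k∉A , k∉B ] (Subset.x∈p∪q⁻ A B k∈AB))) (≡.sym (lookup-at-∉ k∉B))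
      , ≡.trans (lookup-at-∉ k∉A) (≡.sym (lookup-𝟎 k)))

  -- These `n` + 1 vertices form an affine basis of the cube.
  Basic : ∀ {n} → C n → Set
  Basic {n} w = w ≡ 𝟎 ⊎ (∃[ i ] w ≡ at ⁅ i ⁆)

  -- The facet w(i) = -1 contains the singleton of i and no other basic vertex, so the values at
  -- singletons vanish first. Then `𝟎` is alone on the facet w(i₀) = 1; the coordinate `i₀`
  -- guarantees that such a facet exists.
  basic-independent : ∀ {n} {D : Pred (C n → Carrier) 0ℓ} → FacetProperty D → Fin n → ∀ {x} → D x →
    (∀ w → ¬ (x w ≈ 0#) → Basic w) → ∀ w → x w ≈ 0#
  basic-independent {n} D-facet i₀ {x} Dx basic w = ≈0-stable λ xw≉0 → case basic w xw≉0 of λ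
    { (inj₁ ≡.refl) → xw≉0 origin-vanishes ; (inj₂ (i , ≡.refl)) → xw≉0 (unit-vanishes i) }
    where
    unit-vanishes : ∀ i → x (at ⁅ i ⁆) ≈ 0#
    unit-vanishes i = D-facet i Sign.- (at ⁅ i ⁆) Dx (lookup-at-∈ (Subset.x∈⁅x⁆ i)) λ w wi w≢ →
      ≈0-stable λ xw≉0 → case basic w xw≉0 of λ
        { (inj₁ w≡𝟎) → separated i wi (lookup-𝟎 i) w≡𝟎
        ; (inj₂ (j , ≡.refl)) → w≢ (≡.cong (at ∘ ⁅_⁆) (≡.sym (Subset.x∈⁅y⁆⇒x≡y j (lookup-at⁻ wi)))) }
    origin-vanishes : x 𝟎 ≈ 0#
    origin-vanishes = D-facet i₀ Sign.+ 𝟎 Dx (lookup-𝟎 i₀) λ w _ w≢𝟎 →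
      ≈0-stable λ xw≉0 → case basic w xw≉0 of λ
        { (inj₁ w≡𝟎) → w≢𝟎 w≡𝟎 ; (inj₂ (j , ≡.refl)) → xw≉0 (unit-vanishes j) }

  HasParallelograms : ∀ {n} → Pred (C n → Carrier) 0ℓ → Set
  HasParallelograms D = ∀ A B → Splits A B → D (parallelogram (at (A Subset.∪ B)) (at A) (at B) 𝟎)

  -- Modulo the common parallelograms, every element of U is supported on basic
  -- vertices, where U is zero.
  module _ {n} (i₀ : Fin n) {U W : Pred (C n → Carrier) 0ℓ}
           (U-sub : IsSubspace U) (W-sub : IsSubspace W) (U-facet : FacetProperty U)
           (U-par : HasParallelograms U) (W-par : HasParallelograms W) where
    private
      module U = IsSubspace U-sub
      module W = IsSubspace W-sub

    -- Subtracting a multiple of `r` clears `v` from a dependency without bringing any new nonbasic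
    -- vertex into its support, and does so in both spaces at once.
    Reducer : C n → Set
    Reducer v = Σ[ r ∈ (C n → Carrier) ] U r × W r × r v ≈ 1# × (∀ w → w ≢ v → Basic w ⊎ r w ≈ 0#)

    -- Induction on the size of `S`, bounded strictly by `k`: an element i is split off, and the
    -- parallelogram on {i} and the rest `B` trades `S` for `B` and basic vertices.
    reducer-at : ∀ k S → Subset.∣ S ∣ <ⁿ k → Basic (at S) ⊎ Reducer (at S)
    reducer-at (suc k) S (s≤s ∣S∣≤k) with Subset.nonempty? S
    ... | no S≡∅ = inj₁ (inj₁ (≡.trans (≡.cong at (Subset.Empty-unique S≡∅)) at-⊥))
    ... | yes (i , i∈S) with Subset.nonempty? (S Subset.∩ Subset.∁ ⁅ i ⁆)
    ...   | no S∖i≡∅ = inj₁ (inj₂ (i , ≡.cong at (Subset.⊆-antisym S⊆i i⊆S)))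
      where
      S⊆i : S Subset.⊆ ⁅ i ⁆
      S⊆i {j} j∈S with j Subset.∈? ⁅ i ⁆
      ... | yes j∈i = j∈i
      ... | no  j∉i = contradiction (j , Subset.x∈p∩q⁺ (j∈S , Subset.x∉p⇒x∈∁p j∉i)) S∖i≡∅
      i⊆S : ⁅ i ⁆ Subset.⊆ S
      i⊆S j∈i = ≡.subst (_∈ˢ S) (≡.sym (Subset.x∈⁅y⁆⇒x≡y i j∈i)) i∈S
    ...   | yes B≢∅ = ≡.subst (λ S → Basic (at S) ⊎ Reducer (at S)) (Subset.⊆-antisym ⊆S S⊆)
                        (extend (reducer-at k B (ℕ.<-≤-trans (Subset.p⊂q⇒∣p∣<∣q∣ B⊂S) ∣S∣≤k)))
      where
      B = S Subset.∩ Subset.∁ ⁅ i ⁆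
      i∉B : i ∉ˢ B
      i∉B i∈B = Subset.x∈p⇒x∉∁p (Subset.x∈⁅x⁆ i) (proj₂ (Subset.x∈p∩q⁻ S _ i∈B))
      B⊂S : B Subset.⊂ S
      B⊂S = Subset.p∩q⊆p S _ , i , i∈S , i∉B
      ⊆S : ⁅ i ⁆ Subset.∪ B Subset.⊆ S
      ⊆S j∈ with Subset.x∈p∪q⁻ ⁅ i ⁆ B j∈
      ... | inj₁ j∈i = ≡.subst (_∈ˢ S) (≡.sym (Subset.x∈⁅y⁆⇒x≡y i j∈i)) i∈S
      ... | inj₂ j∈B = Subset.p∩q⊆p S _ j∈B
      S⊆ : S Subset.⊆ ⁅ i ⁆ Subset.∪ B
      S⊆ {j} j∈S with j Subset.∈? ⁅ i ⁆
      ... | yes j∈i = Subset.x∈p∪q⁺ (inj₁ j∈i)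
      ... | no  j∉i = Subset.x∈p∪q⁺ (inj₂ (Subset.x∈p∩q⁺ (j∈S , Subset.x∉p⇒x∈∁p j∉i)))
      sp = Splits-⁅⁆ i∉B B≢∅
      open Splits sp
      AB = at (⁅ i ⁆ Subset.∪ B)
      P = parallelogram AB (at ⁅ i ⁆) (at B) 𝟎
      P-AB : P AB ≈ 1#
      P-AB = parallelogram-a {a = AB} {at ⁅ i ⁆} {at B} {𝟎} ≡.refl (AB≢A ∘ ≡.sym) (AB≢B ∘ ≡.sym) (AB≢𝟎 ∘ ≡.sym)
      P-off : ∀ w → w ≢ AB → w ≢ at B → Basic w ⊎ P w ≈ 0#
      P-off w w≢AB w≢B with corner? ⁅ i ⁆ B w
      ... | is-AB p = contradiction (≡.sym p) w≢AB
      ... | is-A p  = inj₁ (inj₂ (i , ≡.sym p))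
      ... | is-B p  = contradiction (≡.sym p) w≢B
      ... | is-𝟎 p  = inj₁ (inj₁ (≡.sym p))
      ... | other p q r s = inj₂ (parallelogram-off {a = AB} {at ⁅ i ⁆} {at B} {𝟎} p q r s)
      extend : Basic (at B) ⊎ Reducer (at B) → Basic AB ⊎ Reducer AB
      extend (inj₁ basic-B) = inj₂ (P , U-par _ _ sp , W-par _ _ sp , P-AB , off)
        where
        off : ∀ w → w ≢ AB → Basic w ⊎ P w ≈ 0#
        off w w≢AB with w ≟ᵛ at B
        ... | yes ≡.refl = inj₁ basic-B
        ... | no  w≢B    = P-off w w≢AB w≢B
      -- The reducer of `B` is known to vanish at `AB` only up to the alternative that `AB` is
      -- basic, in which case there is nothing to reduce.
      extend (inj₂ (r , Ur , Wr , rB≈1 , r-off)) with r-off AB AB≢B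
      ... | inj₁ basic-AB = inj₁ basic-AB
      -- Adding `r` with factor 1 cancels the coefficient `- 1#` of the parallelogram at `B`.
      ... | inj₂ rAB≈0 = inj₂ (_ , U.axpy 1# (U-par _ _ sp) Ur , W.axpy 1# (W-par _ _ sp) Wr ,
              trans (x+c*0≈x 1# rAB≈0) P-AB , off)
        where
        off : ∀ w → w ≢ AB → Basic w ⊎ P w + 1# * r w ≈ 0#
        off w w≢AB with w ≟ᵛ at B
        ... | yes ≡.refl = inj₂ (trans
          (+-cong (parallelogram-c {a = AB} {at ⁅ i ⁆} {at B} {𝟎} AB≢B A≢B ≡.refl (B≢𝟎 ∘ ≡.sym))
                  (trans (*-identityˡ _) rB≈1)) (-‿inverseˡ 1#))
        ... | no w≢B with P-off w w≢AB w≢B | r-off w w≢B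
        ...   | inj₁ basic | _          = inj₁ basic
        ...   | inj₂ _     | inj₁ basic = inj₁ basic
        ...   | inj₂ P≈0   | inj₂ r≈0   = inj₂ (0+c*0≈0 1# P≈0 r≈0)

    reducer : ∀ v → Basic v ⊎ Reducer v
    reducer v = ≡.subst (λ v → Basic v ⊎ Reducer v) (at-minuses v) (reducer-at _ (minuses v) ℕ.≤-refl)

    U⊆W : ∀ {x} → U x → W x
    U⊆W Ux = go (vertices n) Ux (λ w _ → inj₂ (∈-vertices w))
      where
      go : ∀ vs {x} → U x → (∀ w → ¬ (x w ≈ 0#) → Basic w ⊎ w ∈ˡ vs) → W x
      go List.[] Ux basic = W.resp (λ v → sym (basic-independent U-facet i₀ Ux
        (λ w xw≉0 → case basic w xw≉0 of λ { (inj₁ p) → p }) v)) W.origin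
      go (v List.∷ vs) {x} Ux sup with reducer v
      ... | inj₁ basic = go vs Ux λ w xw≉0 → case sup w xw≉0 of λ
              { (inj₁ p) → inj₁ p ; (inj₂ (here ≡.refl)) → inj₁ basic ; (inj₂ (there p)) → inj₂ p }
      -- The vertex `v` is cleared inside `U`, the recursion carries the rest over to `W`, and the
      -- same multiple of `r` is added back there.
      ... | inj₂ (r , Ur , Wr , rv≈1 , r-off) =
              W.resp restore (W.axpy (x v) (go vs (U.axpy (- 1# * x v) Ux Ur) sup′) Wr)
        where
        restore : ∀ w → (x w + (- 1# * x v) * r w) + x v * r w ≈ x w
        restore w = trans
          (solve 4 (λ x m c r → (x :+ (m :* c) :* r) :+ c :* r := x :+ (con 1 :+ m) :* (c :* r)) refl
            (x w) (- 1#) (x v) (r w))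
          (trans (+-congˡ (trans (*-congʳ (-‿inverseʳ 1#)) (zeroˡ _))) (+-identityʳ _))
        sup′ : ∀ w → ¬ (x w + (- 1# * x v) * r w ≈ 0#) → Basic w ⊎ w ∈ˡ vs
        sup′ w yw≉0 with w ≟ᵛ v
        ... | yes ≡.refl = contradiction (trans
          (+-congˡ (trans (*-congˡ rv≈1) (*-identityʳ _))) (x+-1x≈0 (x w))) yw≉0
        ... | no w≢v with r-off w w≢v
        ...   | inj₁ basic = inj₁ basic
        ...   | inj₂ rw≈0 with sup w (λ xw≈0 → yw≉0 (0+c*0≈0 _ xw≈0 rw≈0))
        ...     | inj₁ basic      = inj₁ basic
        ...     | inj₂ (here w≡v) = contradiction w≡v w≢v
        ...     | inj₂ (there p)  = inj₂ p

  -- Positive rescaling.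

  -- A preimage: for positive `s` this is `D` divided pointwise by `s`.
  Rescaled : ∀ {n} → (C n → Carrier) → Pred (C n → Carrier) 0ℓ → Pred (C n → Carrier) 0ℓ
  Rescaled s D x = D (λ v → s v * x v)

  module _ {n} {s : C n → Carrier} (0<s : ∀ v → 0# < s v) {D : Pred (C n → Carrier) 0ℓ} where

    rescaled-isSubspace : IsSubspace D → IsSubspace (Rescaled s D)
    rescaled-isSubspace D-sub = record
      { resp   = λ x≈y → resp (λ v → *-congˡ (x≈y v))
      ; origin = resp (λ v → sym (zeroʳ (s v))) origin
      ; axpy   = λ c {x} {y} Dx Dy → resp
          (λ v → solve 4 (λ s x c y → s :* x :+ c :* (s :* y) := s :* (x :+ c :* y)) refl (s v) (x v) c (y v))
          (axpy c Dx Dy)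
      }
      where open IsSubspace D-sub

    rescaled-facetProperty : FacetProperty D → FacetProperty (Rescaled s D)
    rescaled-facetProperty D-facet i σ e Dx ei off = x*y≈0⇒y≈0 (pos⇒≉0 (0<s e))
      (D-facet i σ e Dx ei (λ w wi w≢e → trans (*-congˡ (off w wi w≢e)) (zeroʳ (s w))))

  -- Positive factors change neither signs nor supports. The map `to` carries the dependency over,
  -- while `from` pulls competitors back to contradict minimality.
  rescale-circuit : ∀ {n} {D D′ : Pred (C n → Carrier) 0ℓ} {s t : C n → Carrier} →
    (∀ v → 0# < s v) → (∀ v → 0# < t v) →
    (∀ {x} → D x → Rescaled s D′ x) → (∀ {x} → D′ x → Rescaled t D x) →
    ∀ {X} → IsMinimalDependency ℝ D X → IsMinimalDependency ℝ D′ X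
  rescale-circuit {s = s} {t} 0<s 0<t to from {X} circuit = record
    { coeff      = λ v → s v * coeff v
    ; dependency = to dependency
    ; hasSigns   = λ v → hasSign-scale {X v} (0<s v) (hasSigns v)
    ; nonempty   = nonempty
    ; minimal    = λ { μ Dμ (f , μf≉0) μ⊆X e e∈X μe≈0 →
        minimal _ (from Dμ) (f , μf≉0 ∘ x*y≈0⇒y≈0 (pos⇒≉0 (0<t f)))
          (λ w tμ≉0 → μ⊆X w (λ μw≈0 → tμ≉0 (trans (*-congˡ μw≈0) (zeroʳ (t w)))))
          e e∈X (trans (*-congˡ μe≈0) (zeroʳ (t e))) }
    }
    where open IsMinimalDependency circuit

  -- The realization compared with the real cube.

  module _ {n} (i₀ : Fin n) {M : OrientedMatroid (C n)} (cube : IsOrientedCube ℝ M)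
           {d} (p : C n → Fin d → Carrier) (realizes : ∀ X → Circuit M X ⇔ Lin ℝ p X) where
    open IsOrientedCube cube
    private
      module R X = Equivalence (realizes X)

      D Aff₀ : Pred (C n → Carrier) 0ℓ
      D    = LinearDependency ℝ p
      Aff₀ = AffineDependency ℝ (point ℝ)

      D-sub : IsSubspace D
      D-sub = linearDependency-isSubspace p

      Aff₀-sub : IsSubspace Aff₀
      Aff₀-sub = affineDependency-isSubspace (point ℝ)

      Aff₀-facet : FacetProperty Aff₀
      Aff₀-facet = facetProperty Aff₀-sub
        (λ i s → IsCocircuit.orthogonal (facetCovector-isCocircuit i s))

      D-facet : FacetProperty D
      D-facet = facetProperty D-sub λ i s X X-circuit → IsCocircuit.orthogonal
        -- The covector of sign `s` is supported on the facet of sign `s`, hence complementary to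
        -- the opposite facet.
        (facets i (Sign.opposite s) (facetCovector i s) (facetCovector-isCocircuit i s) (supp-facetCovector i s))
        X (R.from X X-circuit)

      D-rect : ∀ A B → Splits A B → RectangleDependency D A B
      D-rect A B sp = rectangleDependency sp
        (R.to _ (rectangles _ (rectangle-isSignedRectangle sp)))

    circuit⇔Q : ∀ X → Circuit M X ⇔ Q ℝ n X
    circuit⇔Q X = mk⇔
      (λ c → rescale-circuit 0<t 0<s D⊆ Aff⊆ (R.to X c))
      (λ q → R.from X (rescale-circuit 0<s 0<t Aff⊆ D⊆ q))
      where
      normalised = normalised-parallelograms D-sub D-facet D-rect
      t = proj₁ normalised
      0<t = proj₁ (proj₂ normalised)
      par = proj₂ (proj₂ normalised)
      -- Since `s` inverts `t`, the space `Rescaled s D` consists of the products of `t` with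
      -- elements of `D`, and these include the parallelograms.
      s : C n → Carrier
      s v = proj₁ (reciprocal (0<t v))
      0<s : ∀ v → 0# < s v
      0<s v = proj₁ (proj₂ (reciprocal (0<t v)))
      s*[t*x] : ∀ v x → s v * (t v * x) ≈ x
      s*[t*x] v x = trans (solve 3 (λ s t x → s :* (t :* x) := (t :* s) :* x) refl (s v) (t v) x)
        (trans (*-congʳ (proj₂ (proj₂ (reciprocal (0<t v))))) (*-identityˡ x))
      D′-sub = rescaled-isSubspace 0<s D-sub
      D′-facet = rescaled-facetProperty 0<s {D} D-facet
      D′-par : HasParallelograms (Rescaled s D)
      D′-par A B sp = let x , Dx , t*x≈ = par A B sp in
        IsSubspace.resp D-sub (λ v → trans (sym (s*[t*x] v (x v))) (*-congˡ (t*x≈ v))) Dx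
      -- The hypotheses of `U⊆W` hold for both spaces, so it is applied once in each direction.
      Aff⊆ : ∀ {x} → Aff₀ x → Rescaled s D x
      Aff⊆ = U⊆W i₀ Aff₀-sub D′-sub Aff₀-facet (λ _ _ → Splits⇒affineDependency) D′-par
      D⊆ : ∀ {x} → D x → Rescaled t Aff₀ x
      D⊆ {x} Dx = U⊆W i₀ D′-sub Aff₀-sub D′-facet D′-par (λ _ _ → Splits⇒affineDependency)
        (IsSubspace.resp D-sub (λ v → sym (s*[t*x] v (x v))) Dx)

theorem3p2 : (ℝ : Reals) (n : ℕ) → 1 ≤ n → (M : OrientedMatroid (C n)) →
    IsOrientedCube ℝ M → Realizable ℝ M → Circuit M ≃ Q ℝ n
theorem3p2 ℝ (suc n) _ M cube (d , p , realizes) =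
  -- Rescaling preserves the signed circuits exactly, so the identity relabelling suffices.
  ↔-id (C (suc n)) , Proof.circuit⇔Q ℝ Fin.zero cube p realizes
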